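{- Let $a,b$ be positive integers and $n$ a nonnegative integer, and let $H_{a,b}$ be the graph defined below. Then there are bijections between the following three sets: (1) downs-first cycles in $H_{a,b}$ of length $(a+b)n$ beginning at the origin $(0,0)$; (2) balanced origin-connected weight functions on $H_{a,b}$ with total weight sum $(a+b)n$; (3) ordered sequences of $n$ lap cycles in $H_{a,b}$ beginning at the origin.
   Context: $G_{a,b}$ is the directed graph whose vertices are the pairs $(x,y)\in\mathbb{Z}_{a+b}\times\mathbb{Z}$ with $y\equiv ax\pmod{a+b}$. From each vertex $(x,y)$ there is an up-edge $(x,y)\to(x+1,y+a)$ and a down-edge $(x,y)\to(x+1,y-b)$ ($x+1$ computed in $\mathbb{Z}_{a+b}$). Vertices with $x=0$ are weld points. Representing $x\in\{0,1,\dots,a+b-1\}$, let $h(x)=ax$ for $0\le x\le b$ and $h(x)=ab-b(x-b)$ for $b\le x\le a+b-1$ (so $h$ traces the highest lap cycle from the origin: $b$ up-steps followed by $a$ down-steps). $H_{a,b}$ is the subgraph of $G_{a,b}$ induced on the vertices $(x,y)$ with $y\le h(x)$, i.e. $G_{a,b}$ with all points lying above the highest lap cycle from the origin removed (in particular all weld points $(0,y)$ with $y>0$ are removed), together with all edges of $G_{a,b}$ between remaining vertices. A path is a sequence of vertices $v_0\cdots v_m$ with an edge from $v_{i-1}$ to $v_i$ for each $i$ (repetitions allowed), of length $m$; it is a cycle if $v_0=v_m$. A path is downs-first if for every vertex, all down-steps of the path leaving that vertex occur before all up-steps leaving it. A lap is a path of length $a+b$ that starts and ends at weld points; a lap cycle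 is a lap that is a cycle. A weight function on $H_{a,b}$ assigns a nonnegative integer to each edge of $H_{a,b}$; the in-weight (out-weight) of a vertex is the sum of weights of edges entering (leaving) it; it is balanced if in-weight equals out-weight at every vertex; a path is covered by the weight function if each edge is used by the path at most as many times as its weight; the weight function is origin-connected if for every vertex with positive out-weight there is a covered path from the origin to that vertex. -}

module Defs where

open import Data.Nat as ℕ using (ℕ; zero; suc; _<_; _≤_; _∸_; _≡ᵇ_; _≤ᵇ_)
open import Data.Nat.Properties as ℕP using ()
import Data.Nat.Divisibility as ℕD
open import Data.Integer as ℤ using (ℤ; +_)
import Data.Integer.Properties as ℤP
import Data.Integer.Divisibility as ℤD
open import Data.Bool using (if_then_else_)
open import Data.Product using (Σ; _×_; _,_; proj₁; proj₂)
open import Data.Product.Properties using (≡-dec)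
open import Data.List using (List; []; _∷_; length; map; filter)
open import Data.Nat.ListAction using (sum)
open import Data.List.Relation.Unary.All using (All)
open import Data.List.Relation.Unary.Linked using (Linked)
open import Data.List.Relation.Unary.Unique.Propositional using (Unique)
open import Data.List.Membership.Propositional using (_∈_)
open import Data.Vec as Vec using (Vec)
open import Data.Unit using (⊤)
open import Relation.Nullary using (Dec; yes; no)
open import Relation.Nullary.Decidable using (_×-dec_)
open import Relation.Binary using (Setoid; DecidableEquality)
open import Relation.Binary.PropositionalEquality as ≡ using (_≡_)
import Relation.Binary.Construct.On as On

-- Everything is parameterised by a and b (positivity is a hypothesis of the theorem).
module Graph (a b : ℕ) where

  N : ℕ
  N = a ℕ.+ b

  -- A point (x , y); x ∈ ℤ_{a+b} is represented by 0 ≤ x < a+b.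
  V : Set
  V = ℕ × ℤ

  _≟V_ : DecidableEquality V
  _≟V_ = ≡-dec ℕ._≟_ ℤ._≟_

  origin : V
  origin = (0 , + 0)

  -- x + 1 and x - 1 in ℤ_{a+b} (for 0 ≤ x < a+b)
  next : ℕ → ℕ
  next x = if suc x ≡ᵇ N then 0 else suc x

  prev : ℕ → ℕ
  prev zero    = N ∸ 1
  prev (suc x) = x

  -- the highest lap cycle from the origin
  h : ℕ → ℤ
  h x = if x ≤ᵇ b then + (a ℕ.* x) else (+ (a ℕ.* b) ℤ.- + (b ℕ.* (x ∸ b)))

  IsVertexG : V → Set
  IsVertexG (x , y) = (x < N) × (+ N) ℤD.∣ (y ℤ.- + (a ℕ.* x))

  InH : V → Set
  InH (x , y) = IsVertexG (x , y) × (y ℤ.≤ h x)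

  InH? : (v : V) → Dec (InH v)
  InH? (x , y) = ((x ℕ.<? N) ×-dec (N ℕD.∣? ℤ.∣ y ℤ.- + (a ℕ.* x) ∣)) ×-dec (y ℤ.≤? h x)

  data Dir : Set where
    up down : Dir

  step : V → Dir → V
  step (x , y) up   = (next x , y ℤ.+ + a)
  step (x , y) down = (next x , y ℤ.- + b)

  isWeld : V → Set
  isWeld (x , y) = x ≡ 0

  -- Paths in H_{a,b}: vertex sequences v₀ v₁ ⋯ v_m of vertices of H,
  -- consecutive ones joined by an edge of G (hence of H, induced).

  Edge : V → V → Set
  Edge u v = Σ Dir (λ d → step u d ≡ v)

  record Path : Set where
    constructor path
    field
      start : V
      rest  : List V
      inH   : All InH (start ∷ rest)
      edges : Linked Edge (start ∷ rest)

  open Path public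

  verts : Path → List V
  verts p = start p ∷ rest p

  len : Path → ℕ
  len p = length (rest p)

  lastV : V → List V → V
  lastV v []       = v
  lastV v (w ∷ ws) = lastV w ws

  endV : Path → V
  endV p = lastV (start p) (rest p)

  IsCycle : Path → Set
  IsCycle p = endV p ≡ start p

  IsLap : Path → Set
  IsLap p = (len p ≡ N) × isWeld (start p) × isWeld (endV p)

  steps : V → List V → List (V × V)
  steps v []       = []
  steps v (w ∷ ws) = (v , w) ∷ steps w ws

  -- direction of a step (u , v) of a path (v = step u d)
  dirOf : V × V → Dir
  dirOf (u , v) with v ≟V step u down
  ... | yes _ = down
  ... | no  _ = up

  dirsFrom : Path → V → List Dir
  dirsFrom p u = map dirOf (filter (λ s → proj₁ s ≟V u) (steps (start p) (rest p)))

  DownsBeforeUps : List Dir → Set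
  DownsBeforeUps []          = ⊤
  DownsBeforeUps (down ∷ ds) = DownsBeforeUps ds
  DownsBeforeUps (up ∷ ds)   = All (_≡ up) ds

  DownsFirst : Path → Set
  DownsFirst p = (u : V) → DownsBeforeUps (dirsFrom p u)

  uses : Path → V → Dir → ℕ
  uses p u d = length (filter (λ s → (proj₁ s ≟V u) ×-dec (proj₂ s ≟V step u d))
                              (steps (start p) (rest p)))

  Weight : Set
  Weight = (u : V) (d : Dir) → .(InH u) → .(InH (step u d)) → ℕ

  wAt : Weight → V → Dir → ℕ
  wAt w u d with InH? u | InH? (step u d)
  ... | yes pu | yes pt = w u d pu pt
  ... | _      | _      = 0

  outW : Weight → V → ℕ
  outW w v = wAt w v up ℕ.+ wAt w v down

  -- the edges entering (x , y) come from (x-1 , y-a) (up) and (x-1 , y+b) (down)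
  inW : Weight → V → ℕ
  inW w (x , y) = wAt w (prev x , y ℤ.- + a) up ℕ.+ wAt w (prev x , y ℤ.+ + b) down

  Balanced : Weight → Set
  Balanced w = (v : V) → InH v → inW w v ≡ outW w v

  Covered : Weight → Path → Set
  Covered w p = (u : V) (d : Dir) (pu : InH u) (pt : InH (step u d)) → uses p u d ≤ w u d pu pt

  OriginConnected : Weight → Set
  OriginConnected w = (v : V) → InH v → 0 < outW w v →
    Σ Path (λ p → (start p ≡ origin) × (endV p ≡ v) × Covered w p)

  record HEdge : Set where
    field
      src : V
      dir : Dir
      srcIn : InH src
      tgtIn : InH (step src dir)

  key : HEdge → V × Dir
  key e = (HEdge.src e , HEdge.dir e)

  wt : Weight → HEdge → ℕ
  wt w e = w (HEdge.src e) (HEdge.dir e) (HEdge.srcIn e) (HEdge.tgtIn e)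

  -- the sum of w over all edges of H equals s: w is supported on a finite
  -- list of distinct edges whose weights sum to s
  TotalWeight : Weight → ℕ → Set
  TotalWeight w s = Σ (List HEdge) λ L →
    Unique (map key L) × ((e : HEdge) → 0 < wt w e → key e ∈ map key L) × (sum (map (wt w) L) ≡ s)

  DFCycle : ℕ → Set
  DFCycle n = Σ Path λ p → (start p ≡ origin) × IsCycle p × DownsFirst p × (len p ≡ N ℕ.* n)

  DFCycleSetoid : ℕ → Setoid _ _
  DFCycleSetoid n = On.setoid (≡.setoid (List V)) (λ (c : DFCycle n) → verts (proj₁ c))

  GoodWeight : ℕ → Set
  GoodWeight n = Σ Weight λ w → Balanced w × OriginConnected w × TotalWeight w (N ℕ.* n)

  GoodWeightSetoid : ℕ → Setoid _ _
  GoodWeightSetoid n = record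
    { Carrier = GoodWeight n
    ; _≈_ = λ w w′ → (u : V) (d : Dir) (pu : InH u) (pt : InH (step u d)) →
                       proj₁ w u d pu pt ≡ proj₁ w′ u d pu pt
    ; isEquivalence = record
      { refl  = λ u d pu pt → ≡.refl
      ; sym   = λ e u d pu pt → ≡.sym (e u d pu pt)
      ; trans = λ e f u d pu pt → ≡.trans (e u d pu pt) (f u d pu pt)
      }
    }

  LapCycle : Set
  LapCycle = Σ Path λ p → (start p ≡ origin) × IsLap p × IsCycle p

  LapSeqSetoid : ℕ → Setoid _ _
  LapSeqSetoid n = On.setoid (≡.setoid (Vec (List V) n))
                             (λ (s : Vec LapCycle n) → Vec.map (λ c → verts (proj₁ c)) s)

{-# OPTIONS --safe #-}
module Submission where

-- All three sets are identified with the multisets E of arrows of H which are balanced, lie in H,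
-- have N n elements and in which every arrow can be reached from the origin.
--
-- Cycles: a downs-first cycle is determined by its multiset of arrows. Conversely, walk from the
-- origin, going down while E still allows it; by balance the walk stops at the origin. If arrows
-- were left over at a visited vertex, a walk along left-over arrows would stay above the remaining
-- part of the tour (vertices of one column differ by multiples of N, so walks cannot cross without
-- meeting), hence would come back to the origin, the highest weld point, where nothing is left.
--
-- Laps: stack the n lap cycles, translating each one down by the least multiple of N for which
-- it runs weakly below its predecessor. Consecutive laps then meet, which is connectedness. The
-- top lap of a stack is the one going up whenever the multiset does, so laps can be peeled off one
-- by one, and connectedness says that each gap is the least possible one.

open import Defs
open import Data.Nat as ℕ using (ℕ; zero; suc; _<_; _≤_; z≤n; s≤s; _∸_; _≡ᵇ_)
import Data.Nat.Properties as ℕP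
import Data.Nat.Tactic.RingSolver as ℕSolver
open import Data.Nat.ListAction using (sum)
open import Data.Integer as ℤ using (ℤ; +_)
import Data.Integer.Properties as ℤP
import Data.Integer.Divisibility.Signed as Signed
import Data.Integer.Tactic.RingSolver as ℤSolver
import Algebra.Properties.AbelianGroup ℤP.+-0-abelianGroup as ℤGroup
open import Data.Bool using (true; false; T)
open import Data.Unit using (tt)
open import Data.Empty using (⊥; ⊥-elim)
open import Data.Product using (∃; ∃₂; _×_; _,_; proj₁; proj₂)
open import Data.Product.Properties using (≡-dec)
open import Data.Sum using (_⊎_; inj₁; inj₂)
open import Data.List using (List; []; _∷_; _++_; [_]; length; map; filter; replicate; deduplicate)
import Data.List.Properties as ListP
open import Data.List.Relation.Unary.All as All using (All; []; _∷_)
import Data.List.Relation.Unary.All.Properties as AllP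
open import Data.List.Relation.Unary.Any using (here; there)
open import Data.List.Relation.Unary.AllPairs using ([]; _∷_)
open import Data.List.Relation.Unary.Linked using (Linked; [-]; _∷_)
open import Data.List.Relation.Unary.Unique.Propositional using (Unique)
open import Data.List.Membership.Propositional using (_∈_; _∉_)
import Data.List.Membership.Propositional.Properties as ∈P
import Data.List.Membership.DecPropositional as DecMembership
import Data.List.Relation.Unary.Unique.DecPropositional.Properties as DecUnique
open import Data.List.Relation.Binary.Subset.Propositional using (_⊆_)
open import Data.List.Relation.Binary.Permutation.Propositional using (_↭_; ↭-refl; ↭-sym; ↭-trans; ↭-prep; ↭-reflexive; module PermutationReasoning)
import Data.List.Relation.Binary.Permutation.Propositional.Properties as ↭P
open import Data.Vec as Vec using (Vec; []; _∷_)
import Data.Vec.Properties as VecP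
open import Data.Vec.Relation.Unary.All using ([]; _∷_) renaming (All to VAll)
open import Function using (_∘_)
open import Function.Bundles using (Inverse)
open import Level using (0ℓ)
open import Relation.Nullary using (¬_; Dec; yes; no; contradiction)
open import Relation.Nullary.Decidable using (_×-dec_)
open import Relation.Binary using (DecidableEquality; Setoid)
open import Relation.Binary.PropositionalEquality using (_≡_; _≢_; refl; sym; trans; cong; cong₂; subst; module ≡-Reasoning)

-- Up and down differ by a + b = N, so two walks in one column change their gap, counted in units of
-- N, by at most one per step. They can exchange order only at a common vertex, where the upper walk
-- goes down and the lower one goes up. Both constructions are arranged to exclude this exception:
-- the tour uses up the down arrow of a vertex before going up there, and the top lap never goes
-- down where an up arrow is present. The ceiling of H matters in two ways: no weld point of H lies
-- above the origin, and a closed walk of N steps from the origin has exactly b ups, which keeps it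
-- under the ceiling. A stack does not show which arrows belong to which lap, and the gaps are not
-- recorded. Both are recovered: the top lap is read off by preferring ups, and the next gap is
-- bounded below because the rest of the stack may not cross the top lap, and above because it must
-- be reachable from it.

∈⇒↭∷ : {A : Set} {x : A} {xs : List A} → x ∈ xs → ∃ λ ys → xs ↭ x ∷ ys
∈⇒↭∷ {x = x} x∈xs with ∈P.∈-∃++ x∈xs
... | ys , zs , refl = ys ++ zs , ↭P.shift x ys zs

++-cancelˡ-↭ : {A : Set} (xs : List A) {ys zs : List A} → xs ++ ys ↭ xs ++ zs → ys ↭ zs
++-cancelˡ-↭ []       p = p
++-cancelˡ-↭ (x ∷ xs) p = ++-cancelˡ-↭ xs (↭P.drop-∷ p)

-- A lap has one arrow per column, hence distinct arrows, so membership alone is enough to subtract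
-- it from a multiset.
Unique⊆⇒↭++ : {A : Set} {xs ys : List A} → Unique xs → All (_∈ ys) xs → ∃ λ zs → ys ↭ xs ++ zs
Unique⊆⇒↭++ {ys = ys} [] [] = ys , ↭-refl
Unique⊆⇒↭++ {xs = x ∷ xs} (x≢xs ∷ uniq) (x∈ys ∷ xs⊆ys) with ∈⇒↭∷ x∈ys
... | ys′ , ys↭ with Unique⊆⇒↭++ uniq (All.zipWith (λ (x≢ , ∈ys) → tail∈ x≢ (↭P.∈-resp-↭ ys↭ ∈ys)) (x≢xs , xs⊆ys))
  where
  tail∈ : ∀ {z} → x ≢ z → z ∈ x ∷ ys′ → z ∈ ys′
  tail∈ x≢z (here z≡x)  = contradiction (sym z≡x) x≢z
  tail∈ _   (there z∈) = z∈
... | zs , ys′↭ = zs , ↭-trans ys↭ (↭-prep x ys′↭)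

+-swap : ∀ l m n → l ℕ.+ (m ℕ.+ n) ≡ m ℕ.+ (l ℕ.+ n)
+-swap = ℕSolver.solve-∀

-- Multiplicities as a complete invariant of lists up to permutation

module Counting {A : Set} (_≟_ : DecidableEquality A) where

  count : A → List A → ℕ
  count x xs = length (filter (_≟ x) xs)

  count-∷-≡ : ∀ x xs → count x (x ∷ xs) ≡ suc (count x xs)
  count-∷-≡ x xs = cong length (ListP.filter-accept (_≟ x) refl)

  count-∷-≢ : ∀ {x y} xs → y ≢ x → count x (y ∷ xs) ≡ count x xs
  count-∷-≢ {x} xs y≢x = cong length (ListP.filter-reject (_≟ x) y≢x)

  count-++ : ∀ x xs ys → count x (xs ++ ys) ≡ count x xs ℕ.+ count x ys
  count-++ x xs ys = trans (cong length (ListP.filter-++ (_≟ x) xs ys)) (ListP.length-++ (filter (_≟ x) xs))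

  count-↭ : ∀ x {xs ys} → xs ↭ ys → count x xs ≡ count x ys
  count-↭ x p = ↭P.↭-length (↭P.filter-↭ (_≟ x) p)

  count>0⇒∈ : ∀ {x} xs → 0 < count x xs → x ∈ xs
  count>0⇒∈ {x} (y ∷ xs) 0< with y ≟ x
  ... | yes y≡x = here (sym y≡x)
  ... | no  y≢x = there (count>0⇒∈ xs 0<)

  ∈⇒count>0 : ∀ {x xs} → x ∈ xs → 0 < count x xs
  ∈⇒count>0 {x} {y ∷ xs} x∈ with y ≟ x
  ∈⇒count>0 {x} {y ∷ xs} x∈         | yes _   = s≤s z≤n
  ∈⇒count>0 {x} {y ∷ xs} (here x≡y) | no y≢x = contradiction (sym x≡y) y≢x
  ∈⇒count>0 {x} {y ∷ xs} (there x∈) | no _   = ∈⇒count>0 x∈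

  ∉⇒count≡0 : ∀ {x} xs → x ∉ xs → count x xs ≡ 0
  ∉⇒count≡0 {x} xs x∉ with count x xs in eq
  ... | zero  = refl
  ... | suc _ = contradiction (count>0⇒∈ xs (subst (0 <_) (sym eq) (s≤s z≤n))) x∉

  count-≗⇒↭ : ∀ xs ys → (∀ x → count x xs ≡ count x ys) → xs ↭ ys
  count-≗⇒↭ []       []       eq = ↭-refl
  count-≗⇒↭ []       (y ∷ ys) eq = contradiction (trans (eq y) (count-∷-≡ y ys)) λ ()
  count-≗⇒↭ (x ∷ xs) ys       eq
    with ∈⇒↭∷ (count>0⇒∈ ys (subst (0 <_) (eq x) (∈⇒count>0 (here refl))))
  ... | ys′ , p = ↭-trans (↭-prep x (count-≗⇒↭ xs ys′ eq′)) (↭-sym p)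
    where
    eq′ : ∀ z → count z xs ≡ count z ys′
    eq′ z with trans (eq z) (count-↭ z p)
    ... | q with x ≟ z
    ... | yes _ = ℕP.suc-injective q
    ... | no  _ = q

  count-Unique : ∀ {x xs} → Unique xs → x ∈ xs → count x xs ≡ 1
  count-Unique {x} {y ∷ xs} (y≢ ∷ uniq) (here refl) =
    trans (count-∷-≡ x xs) (cong suc (∉⇒count≡0 xs λ x∈ → All.lookup y≢ x∈ refl))
  count-Unique {x} {y ∷ xs} (y≢ ∷ uniq) (there x∈) =
    trans (count-∷-≢ xs (All.lookup y≢ x∈)) (count-Unique uniq x∈)

  sum-count-∷ : ∀ x xs ks →
    sum (map (λ k → count k (x ∷ xs)) ks) ≡ count x ks ℕ.+ sum (map (λ k → count k xs) ks)
  sum-count-∷ x xs []       = refl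
  -- The two sides test the same equality in opposite orders, so both tests are split and the mixed
  -- cases refuted.
  sum-count-∷ x xs (k ∷ ks) with k ≟ x | x ≟ k | sum-count-∷ x xs ks
  ... | yes _   | yes _   | ih = cong suc (trans (cong (count k xs ℕ.+_) ih) (+-swap (count k xs) (count x ks) _))
  ... | yes k≡x | no x≢k  | _  = contradiction (sym k≡x) x≢k
  ... | no k≢x  | yes x≡k | _  = contradiction (sym x≡k) k≢x
  ... | no _    | no _    | ih = trans (cong (count k xs ℕ.+_) ih) (+-swap (count k xs) (count x ks) _)

  sum-count : ∀ {ks} → Unique ks → ∀ {xs} → All (_∈ ks) xs →
    sum (map (λ k → count k xs) ks) ≡ length xs
  sum-count {ks} uniq {[]} [] = go ks
    where
    go : ∀ js → sum (map (λ k → 0) js) ≡ 0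
    go []       = refl
    go (_ ∷ js) = go js
  sum-count {ks} uniq {x ∷ xs} (x∈ ∷ xs⊆) =
    trans (sum-count-∷ x xs ks) (cong₂ ℕ._+_ (count-Unique uniq x∈) (sum-count uniq xs⊆))

module Bijections (a b : ℕ) (0<a : 0 < a) where

  open Graph a b

  Word : Set
  Word = List Dir

  Arrow : Set
  Arrow = V × Dir

  src tgt : Arrow → V
  src = proj₁
  tgt (u , d) = step u d

  Inside : List Arrow → Set
  Inside = All (λ e → InH (src e) × InH (tgt e))

  _≟D_ : DecidableEquality Dir
  up   ≟D up   = yes refl
  up   ≟D down = no λ ()
  down ≟D up   = no λ ()
  down ≟D down = yes refl

  _≟A_ : DecidableEquality Arrow
  _≟A_ = ≡-dec _≟V_ _≟D_

  open DecMembership _≟A_ using () renaming (_∈?_ to _∈A?_)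

  open DecUnique _≟A_ using (deduplicate-!)

  -- The order on the columns

  infix 4 _≼[_]_ _≼_

  -- The gap is kept as a number and not only as an order, because stacked laps are compared by
  -- their exact gap.
  record _≼[_]_ (u : V) (g : ℕ) (v : V) : Set where
    constructor above
    field
      column : proj₁ u ≡ proj₁ v
      height : proj₂ v ≡ proj₂ u ℤ.+ + g ℤ.* + N
  open _≼[_]_

  _≼_ : V → V → Set
  u ≼ v = ∃ λ g → u ≼[ g ] v

  ≼[0]⇒≡ : ∀ {u v} → u ≼[ 0 ] v → u ≡ v
  ≼[0]⇒≡ {x , y} (above refl refl) = cong (x ,_) (sym (ℤP.+-identityʳ y))

  ≼[0]-refl : ∀ {u} → u ≼[ 0 ] u
  ≼[0]-refl {_ , y} = above refl (sym (ℤP.+-identityʳ y))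

  ≼-refl : ∀ {u} → u ≼ u
  ≼-refl = 0 , ≼[0]-refl

  ≼-trans : ∀ {u v w} → u ≼ v → v ≼ w → u ≼ w
  ≼-trans {_ , y} (g , above refl refl) (h , above refl refl) = g ℕ.+ h , above refl (lemma y (+ g) (+ h) (+ N))
    where
    lemma : ∀ Y G H M → Y ℤ.+ G ℤ.* M ℤ.+ H ℤ.* M ≡ Y ℤ.+ (G ℤ.+ H) ℤ.* M
    lemma = ℤSolver.solve-∀

  ≼⇒≤ : ∀ {u v} → u ≼ v → proj₂ u ℤ.≤ proj₂ v
  ≼⇒≤ {_ , y} (g , above refl refl) rewrite sym (ℤP.pos-* g N) = ℤP.i≤i+j y (+ (g ℕ.* N))

  ≼-antisym : ∀ {u v} → u ≼ v → v ≼ u → u ≡ v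
  ≼-antisym u≼v v≼u = cong₂ _,_ (column (proj₂ u≼v)) (ℤP.≤-antisym (≼⇒≤ u≼v) (≼⇒≤ v≼u))

  residue-gap : ∀ {c} y z p q → y ℤ.- c ≡ p ℤ.* + N → z ℤ.- c ≡ q ℤ.* + N → p ℤ.≤ q →
    z ≡ y ℤ.+ + ℤ.∣ q ℤ.- p ∣ ℤ.* + N
  residue-gap {c} y z p q eq eq′ p≤q = begin
    z                                         ≡⟨ regroup y z c ⟩
    y ℤ.+ ((z ℤ.- c) ℤ.- (y ℤ.- c))           ≡⟨ cong (λ t → y ℤ.+ t) (cong₂ ℤ._-_ eq′ eq) ⟩
    y ℤ.+ (q ℤ.* + N ℤ.- p ℤ.* + N)           ≡⟨ cong (λ t → y ℤ.+ t) (factor p q (+ N)) ⟩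
    y ℤ.+ (q ℤ.- p) ℤ.* + N                   ≡⟨ cong (λ t → y ℤ.+ t ℤ.* + N) (sym (ℤP.0≤i⇒+∣i∣≡i (ℤP.i≤j⇒0≤j-i p≤q))) ⟩
    y ℤ.+ + ℤ.∣ q ℤ.- p ∣ ℤ.* + N             ∎
    where
    open ≡-Reasoning
    regroup : ∀ Y Z X → Z ≡ Y ℤ.+ ((Z ℤ.- X) ℤ.- (Y ℤ.- X))
    regroup = ℤSolver.solve-∀
    factor : ∀ P Q M → Q ℤ.* M ℤ.- P ℤ.* M ≡ (Q ℤ.- P) ℤ.* M
    factor = ℤSolver.solve-∀

  ≼-total : ∀ {u v} → IsVertexG u → IsVertexG v → proj₁ u ≡ proj₁ v → u ≼ v ⊎ v ≼ u
  ≼-total {x , y} {_ , z} (_ , N∣) (_ , N∣′) refl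
    with Signed.∣ᵤ⇒∣ {i = y ℤ.- + (a ℕ.* x)} N∣ | Signed.∣ᵤ⇒∣ {i = z ℤ.- + (a ℕ.* x)} N∣′
  ... | Signed.divides p eq | Signed.divides q eq′ with ℤP.≤-total p q
  ...   | inj₁ p≤q = inj₁ (ℤ.∣ q ℤ.- p ∣ , above refl (residue-gap y z p q eq eq′ p≤q))
  ...   | inj₂ q≤p = inj₂ (ℤ.∣ p ℤ.- q ∣ , above refl (residue-gap z y q p eq′ eq q≤p))

  step-same : ∀ {u v g} d → u ≼[ g ] v → step u d ≼[ g ] step v d
  step-same {_ , y} {g = g} up (above refl refl) = above refl (lemma y (+ g ℤ.* + N) (+ a))
    where
    lemma : ∀ Y G A → Y ℤ.+ G ℤ.+ A ≡ Y ℤ.+ A ℤ.+ G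
    lemma = ℤSolver.solve-∀
  step-same {_ , y} {g = g} down (above refl refl) = above refl (lemma y (+ g ℤ.* + N) (+ b))
    where
    lemma : ∀ Y G B → Y ℤ.+ G ℤ.- B ≡ Y ℤ.- B ℤ.+ G
    lemma = ℤSolver.solve-∀

  -- The two steps diverge by a + b, which is one unit of gap. `step-together` is the converse and
  -- needs a positive gap to start from.
  step-apart : ∀ {u v g} → u ≼[ g ] v → step u down ≼[ suc g ] step v up
  step-apart {_ , y} {g = g} (above refl refl) = above refl (lemma y (+ g) (+ a) (+ b))
    where
    lemma : ∀ Y G A B → Y ℤ.+ G ℤ.* (A ℤ.+ B) ℤ.+ A ≡ Y ℤ.- B ℤ.+ (+ 1 ℤ.+ G) ℤ.* (A ℤ.+ B)
    lemma = ℤSolver.solve-∀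

  step-together : ∀ {u v g} → u ≼[ suc g ] v → step u up ≼[ g ] step v down
  step-together {_ , y} {g = g} (above refl refl) = above refl (lemma y (+ g) (+ a) (+ b))
    where
    lemma : ∀ Y G A B → Y ℤ.+ (+ 1 ℤ.+ G) ℤ.* (A ℤ.+ B) ℤ.- B ≡ Y ℤ.+ A ℤ.+ G ℤ.* (A ℤ.+ B)
    lemma = ℤSolver.solve-∀

  -- The second alternative is the one way to cross: zero gap, with the lower walk going up and the
  -- upper one down.
  step-mono : ∀ {u v} → u ≼ v → ∀ d e → step u d ≼ step v e ⊎ (u ≡ v × d ≡ up × e ≡ down)
  step-mono (g     , p) up   up   = inj₁ (g , step-same up p)
  step-mono (g     , p) down down = inj₁ (g , step-same down p)
  step-mono (g     , p) down up   = inj₁ (suc g , step-apart p)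
  step-mono (zero  , p) up   down = inj₂ (≼[0]⇒≡ p , refl , refl)
  step-mono (suc g , p) up   down = inj₁ (g , step-together p)

  up⋠down : ∀ {u} → ¬ step u up ≼ step u down
  up⋠down {_ , y} p = ℤP.<⇒≱ (ℤP.+-monoʳ-< y -b<a) (≼⇒≤ p)
    where
    -b<a : ℤ.- + b ℤ.< + a
    -b<a = ℤP.≤-<-trans (ℤP.neg-mono-≤ (ℤ.+≤+ z≤n)) (ℤ.+<+ 0<a)

  step-injectiveʳ : ∀ u d e → step u d ≡ step u e → d ≡ e
  step-injectiveʳ u up   up   _  = refl
  step-injectiveʳ u down down _  = refl
  step-injectiveʳ u up   down eq = ⊥-elim (up⋠down {u} (subst (step u up ≼_) eq ≼-refl))
  step-injectiveʳ u down up   eq = ⊥-elim (up⋠down {u} (subst (step u up ≼_) (sym eq) ≼-refl))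

  -- Words and their trails

  run : V → Word → V
  run v []       = v
  run v (d ∷ ds) = run (step v d) ds

  trail : V → Word → List Arrow
  trail v []       = []
  trail v (d ∷ ds) = (v , d) ∷ trail (step v d) ds

  run-++ : ∀ v l m → run v (l ++ m) ≡ run (run v l) m
  run-++ v []      m = refl
  run-++ v (d ∷ l) m = run-++ (step v d) l m

  trail-++ : ∀ v l m → trail v (l ++ m) ≡ trail v l ++ trail (run v l) m
  trail-++ v []      m = refl
  trail-++ v (d ∷ l) m = cong ((v , d) ∷_) (trail-++ (step v d) l m)

  length-trail : ∀ v l → length (trail v l) ≡ length l
  length-trail v []      = refl
  length-trail v (d ∷ l) = cong suc (length-trail (step v d) l)

  src-trail : ∀ v l → map src (trail v l) ++ [ run v l ] ≡ v ∷ map tgt (trail v l)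
  src-trail v []      = refl
  src-trail v (d ∷ l) = cong (v ∷_) (src-trail (step v d) l)

  visited-split : ∀ v l {u} → u ∈ v ∷ map tgt (trail v l) →
    ∃₂ λ l₁ l₂ → l ≡ l₁ ++ l₂ × run v l₁ ≡ u
  visited-split v l       (here refl)           = [] , l , refl , refl
  visited-split v (d ∷ l) (there u∈) with visited-split (step v d) l u∈
  ... | l₁ , l₂ , refl , eq = d ∷ l₁ , l₂ , refl , eq

  src⊆visited : ∀ v l {u} → u ∈ map src (trail v l) → u ∈ v ∷ map tgt (trail v l)
  src⊆visited v l u∈ = subst (_ ∈_) (src-trail v l) (∈P.∈-++⁺ˡ u∈)

  arrow∈ : ∀ {u E} → u ∈ map src E → ∃ λ d → (u , d) ∈ E
  arrow∈ u∈ with ∈P.∈-map⁻ src u∈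
  ... | (_ , d) , e∈ , refl = d , e∈

  src∈ : ∀ {u d E} → (u , d) ∈ E → u ∈ map src E
  src∈ = ∈P.∈-map⁺ src

  tgt∈ : ∀ {u d E} → (u , d) ∈ E → step u d ∈ map tgt E
  tgt∈ = ∈P.∈-map⁺ tgt

  -- Balanced and connected multisets of arrows

  Balancedᴸ : List Arrow → Set
  Balancedᴸ E = map src E ↭ map tgt E

  -- Sources and targets telescope along the trail, so removing it from a balanced multiset disturbs
  -- the balance only at its two ends. For a closed trail the two extra entries cancel.
  trail-flow : ∀ v l R → Balancedᴸ (trail v l ++ R) → v ∷ map src R ↭ run v l ∷ map tgt R
  trail-flow v l R bal = ++-cancelˡ-↭ (map tgt P)
    (begin
      map tgt P ++ v ∷ map src R            ↭⟨ ↭P.shift v (map tgt P) (map src R) ⟩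
      (v ∷ map tgt P) ++ map src R          ≡⟨ cong (_++ map src R) (sym (src-trail v l)) ⟩
      (map src P ++ [ w ]) ++ map src R     ≡⟨ ListP.++-assoc (map src P) [ w ] (map src R) ⟩
      map src P ++ w ∷ map src R            ↭⟨ ↭P.shift w (map src P) (map src R) ⟩
      w ∷ map src P ++ map src R            ≡⟨ cong (w ∷_) (sym (ListP.map-++ src P R)) ⟩
      w ∷ map src (P ++ R)                  ↭⟨ ↭-prep w bal ⟩
      w ∷ map tgt (P ++ R)                  ≡⟨ cong (w ∷_) (ListP.map-++ tgt P R) ⟩
      w ∷ map tgt P ++ map tgt R            ↭⟨ ↭-sym (↭P.shift w (map tgt P) (map tgt R)) ⟩
      map tgt P ++ w ∷ map tgt R            ∎)
    where
    open PermutationReasoning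
    P = trail v l
    w = run v l

  cycle-balanced : ∀ v l → run v l ≡ v → Balancedᴸ (trail v l)
  cycle-balanced v l eq = ↭P.drop-∷ (↭-trans (↭P.∷↭∷ʳ v (map src (trail v l)))
    (↭-reflexive (trans (cong (λ w → map src (trail v l) ++ [ w ]) (sym eq)) (src-trail v l))))

  balanced-resp-↭ : ∀ {E F} → E ↭ F → Balancedᴸ E → Balancedᴸ F
  balanced-resp-↭ p bal = ↭-trans (↭-sym (↭P.map⁺ src p)) (↭-trans bal (↭P.map⁺ tgt p))

  balanced-++ : ∀ {E F} → Balancedᴸ E → Balancedᴸ F → Balancedᴸ (E ++ F)
  balanced-++ {E} {F} p q rewrite ListP.map-++ src E F | ListP.map-++ tgt E F = ↭P.++⁺ p q

  infixl 5 _▻_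

  -- Arrows may be reused here, unlike in a covered path. For good multisets nothing is lost:
  -- initial segments of the tour reach the same sources without exceeding any multiplicity.
  data Reach (E : List Arrow) (v : V) : V → Set where
    stop : Reach E v v
    _▻_  : ∀ {u d} → Reach E v u → (u , d) ∈ E → Reach E v (step u d)

  reach-trans : ∀ {E u v w} → Reach E u v → Reach E v w → Reach E u w
  reach-trans p stop    = p
  reach-trans p (q ▻ e) = reach-trans p q ▻ e

  reach-mono : ∀ {E F u v} → E ⊆ F → Reach E u v → Reach F u v
  reach-mono E⊆F stop    = stop
  reach-mono E⊆F (p ▻ e) = reach-mono E⊆F p ▻ E⊆F e

  reach-run : ∀ {E} v l → trail v l ⊆ E → Reach E v (run v l)
  reach-run v []      _   = stop
  reach-run v (d ∷ l) sub = reach-trans (stop ▻ sub (here refl)) (reach-run (step v d) l (sub ∘ there))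

  trail-++ˡ-⊆ : ∀ v l m → trail v l ⊆ trail v (l ++ m)
  trail-++ˡ-⊆ v l m e∈ = subst (_ ∈_) (sym (trail-++ v l m)) (∈P.∈-++⁺ˡ e∈)

  trail-++ʳ-⊆ : ∀ v l m → trail (run v l) m ⊆ trail v (l ++ m)
  trail-++ʳ-⊆ v l m e∈ = subst (_ ∈_) (sym (trail-++ v l m)) (∈P.∈-++⁺ʳ (trail v l) e∈)

  reach-visited : ∀ {E} v l {u} → trail v l ⊆ E → u ∈ v ∷ map tgt (trail v l) →
    Reach E v u × Reach E u (run v l)
  reach-visited {E} v l sub u∈ with visited-split v l u∈
  ... | l₁ , l₂ , refl , refl =
    reach-run v l₁ (sub ∘ trail-++ˡ-⊆ v l₁ l₂) ,
    subst (Reach E (run v l₁)) (sym (run-++ v l₁ l₂)) (reach-run (run v l₁) l₂ (sub ∘ trail-++ʳ-⊆ v l₁ l₂))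

  -- The base point varies because peeling laps off a stack leaves multisets that start at lower
  -- weld points.
  record Good (o : V) (E : List Arrow) : Set where
    field
      inside    : Inside E
      balanced  : Balancedᴸ E
      connected : ∀ {u} → u ∈ map src E → Reach E o u
  open Good

  -- Downs-first trails

  -- Phrased through the remaining arrows, so that it can be read off letter by letter: after an
  -- up-step no down-step from the same vertex may follow.
  data DownsFirstᴸ : List Arrow → Set where
    []    : DownsFirstᴸ []
    down∷ : ∀ {u E} → DownsFirstᴸ E → DownsFirstᴸ ((u , down) ∷ E)
    up∷   : ∀ {u E} → (u , down) ∉ E → DownsFirstᴸ E → DownsFirstᴸ ((u , up) ∷ E)

  ∉-∷-up : ∀ {u v : V} {E} → (u , down) ∉ E → (u , down) ∉ (v , up) ∷ E
  ∉-∷-up ∉E (there ∈E) = ∉E ∈E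

  -- The multiset dictates each letter: a first step up certifies that the down arrow at v is
  -- absent, so two words with the same multiset begin alike and the first arrow cancels.
  downsFirst-unique : ∀ v l m → DownsFirstᴸ (trail v l) → DownsFirstᴸ (trail v m) →
    trail v l ↭ trail v m → l ≡ m
  downsFirst-unique v []         []         _          _          _ = refl
  downsFirst-unique v []         (d ∷ m)    _          _          p = contradiction (↭-sym p) ↭P.¬x∷xs↭[]
  downsFirst-unique v (d ∷ l)    []         _          _          p = contradiction p ↭P.¬x∷xs↭[]
  downsFirst-unique v (up ∷ l)   (up ∷ m)   (up∷ _ p)  (up∷ _ q)  r = cong (up ∷_) (downsFirst-unique _ l m p q (↭P.drop-∷ r))
  downsFirst-unique v (down ∷ l) (down ∷ m) (down∷ p)  (down∷ q)  r = cong (down ∷_) (downsFirst-unique _ l m p q (↭P.drop-∷ r))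
  downsFirst-unique v (up ∷ l)   (down ∷ m) (up∷ ∉l _) _          r = contradiction (↭P.∈-resp-↭ (↭-sym r) (here refl)) (∉-∷-up ∉l)
  downsFirst-unique v (down ∷ l) (up ∷ m)   _          (up∷ ∉m _) r = contradiction (↭P.∈-resp-↭ r (here refl)) (∉-∷-up ∉m)

  -- `exhausted` is what remains of the greedy choice once the walk is over: wherever it went up, no
  -- down arrow is left over.
  record Greedy (E : List Arrow) (v : V) : Set where
    field
      word       : Word
      left       : List Arrow
      split      : E ↭ trail v word ++ left
      downsFirst : DownsFirstᴸ (trail v word)
      exhausted  : ∀ {u} → (u , up) ∈ trail v word → (u , down) ∉ left
      stuck      : run v word ∉ map src left

  -- The recursion is on the length, since the list left after removing an arrow is obtained through
  -- a permutation and is not structurally smaller.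
  greedy : ∀ n E → length E ≡ n → ∀ v → Greedy E v
  greedy zero    []      _   v = record
    { word = [] ; left = [] ; split = ↭-refl ; downsFirst = [] ; exhausted = λ () ; stuck = λ () }
  greedy (suc n) E len v with (v , down) ∈A? E | (v , up) ∈A? E
  ... | yes ∈E | _ with ∈⇒↭∷ ∈E
  ...   | E′ , p = record
    { word = down ∷ word ; left = left ; split = ↭-trans p (↭-prep _ split)
    ; downsFirst = down∷ downsFirst ; exhausted = λ { (there up∈) → exhausted up∈ } ; stuck = stuck }
    where open Greedy (greedy n E′ (ℕP.suc-injective (trans (sym (↭P.↭-length p)) len)) (step v down))
  greedy (suc n) E len v | no ∉E | yes ∈E with ∈⇒↭∷ ∈E
  ...   | E′ , p = record
    { word = up ∷ word ; left = left ; split = ↭-trans p (↭-prep _ split)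
    ; downsFirst = up∷ (∉E′ ∘ ∈P.∈-++⁺ˡ) downsFirst
    ; exhausted = λ { (here refl) → ∉E′ ∘ ∈P.∈-++⁺ʳ (trail (step v up) word) ; (there up∈) → exhausted up∈ }
    ; stuck = stuck }
    where
    open Greedy (greedy n E′ (ℕP.suc-injective (trans (sym (↭P.↭-length p)) len)) (step v up))
    ∉E′ : (v , down) ∉ trail (step v up) word ++ left
    ∉E′ ∈E′ = ∉E (↭P.∈-resp-↭ (↭-sym p) (there (↭P.∈-resp-↭ (↭-sym split) ∈E′)))
  greedy (suc n) E len v | no ∉down | no ∉up = record
    { word = [] ; left = E ; split = ↭-refl ; downsFirst = [] ; exhausted = λ () ; stuck = stuck }
    where
    stuck : v ∉ map src E
    stuck v∈ with arrow∈ v∈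
    ... | up   , ∈E = ∉up ∈E
    ... | down , ∈E = ∉down ∈E

  origin-top : ∀ {v} → origin ≼ v → InH v → v ≡ origin
  origin-top {_ , y} p@(_ , above refl _) (_ , y≤h) = cong (0 ,_) (ℤP.≤-antisym (subst (y ℤ.≤_) (cong +_ (ℕP.*-zeroʳ a)) y≤h) (≼⇒≤ p))

  record Tour (E : List Arrow) : Set where
    field
      word       : Word
      downsFirst : DownsFirstᴸ (trail origin word)
      closed     : run origin word ≡ origin
      uses-all   : trail origin word ↭ E

  tour : ∀ {E} → Good origin E → Tour E
  tour {E} good = record
    { word = word ; downsFirst = downsFirst ; closed = closed
    ; uses-all = ↭-sym (↭-trans split (↭-reflexive (trans (cong (P ++_) left≡[]) (ListP.++-identityʳ P)))) }
    where
    open Greedy (greedy (length E) E refl origin)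
    P = trail origin word

    flow : origin ∷ map src left ↭ run origin word ∷ map tgt left
    flow = trail-flow origin word left (balanced-resp-↭ split (balanced good))

    closed : run origin word ≡ origin
    closed with ↭P.∈-resp-↭ (↭-sym flow) (here refl)
    ... | here eq  = eq
    ... | there ∈R = contradiction ∈R stuck

    flow′ : map src left ↭ map tgt left
    flow′ = ↭P.drop-∷ (subst (λ z → origin ∷ map src left ↭ z ∷ map tgt left) closed flow)

    left⊆ : left ⊆ E
    left⊆ e∈ = ↭P.∈-resp-↭ (↭-sym split) (∈P.∈-++⁺ʳ P e∈)

    P⊆ : P ⊆ E
    P⊆ e∈ = ↭P.∈-resp-↭ (↭-sym split) (∈P.∈-++⁺ˡ e∈)

    -- Any left-over arrow at π stays above the step from q unless the walks cross at q = π, with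
    -- the step from q up and the left-over arrow down. If that up arrow belongs to the tour,
    -- `exhausted` forbids the down arrow; otherwise it is itself left over and can be taken
    -- instead.
    step-in-left : ∀ {π q} d → q ≼ π → π ∈ map src left → (q , d) ∈ E →
      ∃ λ e → (π , e) ∈ left × step q d ≼ step π e
    step-in-left {π} {q} d q≼π π∈ q∈E with arrow∈ π∈
    ... | e , e∈ with step-mono q≼π d e
    ... | inj₁ le = e , e∈ , le
    ... | inj₂ (refl , refl , refl) with ∈P.∈-++⁻ P (↭P.∈-resp-↭ split q∈E)
    ...   | inj₁ ∈P = contradiction e∈ (exhausted ∈P)
    ...   | inj₂ ∈R = up , ∈R , ≼-refl

    -- A walk in left starting on the tour stays above the remainder of the tour, so it is
    -- led to the origin, from which no arrow of left leaves.
    no-escape : ∀ {π} q l → trail q l ⊆ E → run q l ≡ origin → q ≼ π → π ∈ map src left → ⊥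
    no-escape q [] sub refl q≼π π∈ with arrow∈ π∈
    ... | e , e∈ = stuck (subst (_∈ map src left)
      (trans (origin-top q≼π (proj₁ (All.lookup (inside good) (left⊆ e∈)))) (sym closed)) π∈)
    no-escape q (d ∷ l) sub eq q≼π π∈ with step-in-left d q≼π π∈ (sub (here refl))
    ... | e , e∈ , le = no-escape (step q d) l (sub ∘ there) eq le (↭P.∈-resp-↭ (↭-sym flow′) (tgt∈ e∈))

    visited∉left : ∀ {u} → u ∈ origin ∷ map tgt P → u ∉ map src left
    visited∉left u∈ with visited-split origin word u∈
    ... | l₁ , l₂ , eq , refl = no-escape (run origin l₁) l₂
      (P⊆ ∘ subst (λ l → trail (run origin l₁) l₂ ⊆ trail origin l) (sym eq) (trail-++ʳ-⊆ origin l₁ l₂))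
      (trans (sym (run-++ origin l₁ l₂)) (trans (cong (run origin) (sym eq)) closed)) ≼-refl

    -- A visited vertex emits no left-over arrow, so each further arrow of the walk is an arrow of
    -- the tour.
    reached⇒visited : ∀ {u} → Reach E origin u → u ∈ origin ∷ map tgt P
    reached⇒visited stop = here refl
    reached⇒visited (r ▻ e∈) with ∈P.∈-++⁻ P (↭P.∈-resp-↭ split e∈)
    ... | inj₁ ∈P = there (tgt∈ ∈P)
    ... | inj₂ ∈R = contradiction (src∈ ∈R) (visited∉left (reached⇒visited r))

    left≡[] : left ≡ []
    left≡[] with left in eq
    ... | []          = refl
    ... | (u , d) ∷ R = ⊥-elim (visited∉left (reached⇒visited (connected good (src∈ (left⊆ e∈)))) (src∈ e∈))
      where
      e∈ : (u , d) ∈ left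
      e∈ = subst ((u , d) ∈_) (sym eq) (here refl)

  0<N : 0 < N
  0<N = ℕP.≤-trans 0<a (ℕP.m≤m+n a b)

  instance
    N-nonZero : ℕ.NonZero N
    N-nonZero = ℕ.>-nonZero 0<N

  -- Columns

  next-< : ∀ {x} → suc x < N → next x ≡ suc x
  next-< {x} lt with suc x ≡ᵇ N in eq
  ... | false = refl
  ... | true  = contradiction (ℕP.≡ᵇ⇒≡ (suc x) N (subst T (sym eq) _)) (ℕP.<⇒≢ lt)

  next-≡ : ∀ {x} → suc x ≡ N → next x ≡ 0
  next-≡ {x} sx≡N with suc x ≡ᵇ N in eq
  ... | true  = refl
  ... | false = ⊥-elim (subst T eq (ℕP.≡⇒≡ᵇ (suc x) N sx≡N))

  next-injective : ∀ {x y} → x < N → y < N → next x ≡ next y → x ≡ y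
  next-injective {x} {y} x<N y<N eq with ℕP.m≤n⇒m<n∨m≡n x<N | ℕP.m≤n⇒m<n∨m≡n y<N
  ... | inj₁ p | inj₁ q = ℕP.suc-injective (trans (sym (next-< p)) (trans eq (next-< q)))
  ... | inj₁ p | inj₂ q = contradiction (trans (sym (next-< p)) (trans eq (next-≡ q))) λ ()
  ... | inj₂ p | inj₁ q = contradiction (trans (sym (next-≡ p)) (trans eq (next-< q))) λ ()
  ... | inj₂ p | inj₂ q = ℕP.suc-injective (trans p (sym q))

  step-column : ∀ u d → proj₁ (step u d) ≡ next (proj₁ u)
  step-column u up   = refl
  step-column u down = refl

  step-column-< : ∀ u d {n} → proj₁ u ℕ.+ suc (suc n) ≤ N → proj₁ (step u d) ≡ suc (proj₁ u)
  step-column-< u d {n} le = trans (step-column u d)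
    (next-< (ℕP.≤-trans (subst (_≤ proj₁ u ℕ.+ suc (suc n)) (ℕP.+-comm (proj₁ u) 2) (ℕP.+-monoʳ-≤ (proj₁ u) (s≤s (s≤s z≤n)))) le))

  step-room : ∀ u d {n} → proj₁ u ℕ.+ suc (suc n) ≤ N → proj₁ (step u d) ℕ.+ suc n ≤ N
  step-room u d {n} le rewrite step-column-< u d le = subst (_≤ N) (ℕP.+-suc (proj₁ u) (suc n)) le

  run-column : ∀ v l → proj₁ v < N → proj₁ v ℕ.+ length l ≡ N → proj₁ (run v l) ≡ 0
  run-column v [] v<N eq = contradiction (trans (sym (ℕP.+-identityʳ _)) eq) (ℕP.<⇒≢ v<N)
  run-column v (d ∷ []) v<N eq = trans (step-column v d) (next-≡ (trans (ℕP.+-comm 1 (proj₁ v)) eq))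
  run-column v (d ∷ l@(_ ∷ l′)) v<N eq = run-column (step v d) l
    (subst (_≤ N) (ℕP.+-comm (proj₁ (step v d)) 1)
      (ℕP.≤-trans (ℕP.+-monoʳ-≤ (proj₁ (step v d)) (s≤s z≤n)) (step-room v d (ℕP.≤-reflexive eq))))
    (trans (cong (ℕ._+ length l) (step-column-< v d (ℕP.≤-reflexive eq)))
      (trans (sym (ℕP.+-suc (proj₁ v) (length l))) eq))

  trail-columns : ∀ {t} v l → t ≤ proj₁ v → proj₁ v ℕ.+ length l ≤ N →
    All (λ e → t ≤ proj₁ (src e)) (trail v l)
  trail-columns v []            t≤ le = []
  trail-columns v (d ∷ [])      t≤ le = t≤ ∷ []
  trail-columns v (d ∷ l@(_ ∷ _)) t≤ le = t≤ ∷ trail-columns (step v d) l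
    (subst (_ ≤_) (sym (step-column-< v d le)) (ℕP.m≤n⇒m≤1+n t≤)) (step-room v d le)

  trail-columns-tail : ∀ v d l → proj₁ v ℕ.+ length (d ∷ l) ≤ N →
    All (λ e → proj₁ v < proj₁ (src e)) (trail (step v d) l)
  trail-columns-tail v d []        le = []
  trail-columns-tail v d l@(_ ∷ _) le =
    trail-columns (step v d) l (ℕP.≤-reflexive (sym (step-column-< v d le))) (step-room v d le)

  -- The bound keeps the trail from wrapping round, so the column of the source grows by one with
  -- each arrow.
  trail-column-injective : ∀ v l → proj₁ v ℕ.+ length l ≤ N → ∀ {e f} → e ∈ trail v l → f ∈ trail v l →
    proj₁ (src e) ≡ proj₁ (src f) → e ≡ f
  trail-column-injective v (d ∷ l) le (here refl) (here refl) eq = refl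
  trail-column-injective v (d ∷ l) le (here refl) (there f∈)  eq =
    contradiction eq (ℕP.<⇒≢ (All.lookup (trail-columns-tail v d l le) f∈))
  trail-column-injective v (d ∷ l) le (there e∈)  (here refl) eq =
    contradiction (sym eq) (ℕP.<⇒≢ (All.lookup (trail-columns-tail v d l le) e∈))
  trail-column-injective v (d ∷ l@(_ ∷ _)) le (there e∈) (there f∈) eq =
    trail-column-injective (step v d) l (step-room v d le) e∈ f∈ eq

  trail-unique : ∀ v l → proj₁ v ℕ.+ length l ≤ N → Unique (trail v l)
  trail-unique v []              le = []
  trail-unique v (d ∷ [])        le = [] ∷ []
  trail-unique v (d ∷ l@(_ ∷ _)) le =
    All.map (λ lt eq → ℕP.<⇒≢ lt (cong (proj₁ ∘ src) eq)) (trail-columns-tail v d l le)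
    ∷ trail-unique (step v d) l (step-room v d le)

  -- Vertical translation

  lower : ℕ → V → V
  lower k (x , y) = x , y ℤ.- + k ℤ.* + N

  weld : ℕ → V
  weld k = lower k origin

  step-lower : ∀ k v d → step (lower k v) d ≡ lower k (step v d)
  step-lower k (x , y) up   = cong (next x ,_) (swap y (+ k ℤ.* + N) (+ a))
    where
    swap : ∀ Y K A → Y ℤ.- K ℤ.+ A ≡ Y ℤ.+ A ℤ.- K
    swap = ℤSolver.solve-∀
  step-lower k (x , y) down = cong (next x ,_) (swap y (+ k ℤ.* + N) (+ b))
    where
    swap : ∀ Y K B → Y ℤ.- K ℤ.- B ≡ Y ℤ.- B ℤ.- K
    swap = ℤSolver.solve-∀

  run-lower : ∀ k v l → run (lower k v) l ≡ lower k (run v l)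
  run-lower k v []      = refl
  run-lower k v (d ∷ l) = trans (cong (λ u → run u l) (step-lower k v d)) (run-lower k (step v d) l)

  trail-lower : ∀ k v l → trail (lower k v) l ≡ map (λ (u , d) → lower k u , d) (trail v l)
  trail-lower k v []      = refl
  trail-lower k v (d ∷ l) = cong (_ ∷_) (trans (cong (λ u → trail u l) (step-lower k v d)) (trail-lower k (step v d) l))

  lower-injective : ∀ k {u v} → lower k u ≡ lower k v → u ≡ v
  lower-injective k {x , y} {x′ , y′} eq = cong₂ _,_ (cong proj₁ eq)
    (ℤGroup.∙-cancelʳ (ℤ.- (+ k ℤ.* + N)) y y′ (cong proj₂ eq))

  weld-injective : ∀ {k m} → weld k ≡ weld m → k ≡ m
  weld-injective {k} {m} eq = ℤP.+-injective (ℤP.*-cancelʳ-≡ (+ k) (+ m) (+ N)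
    (ℤP.neg-injective (ℤGroup.∙-cancelˡ (+ 0) _ _ (cong proj₂ eq))))

  lower-≼ : ∀ k g v → lower (k ℕ.+ g) v ≼[ g ] lower k v
  lower-≼ k g (x , y) = above refl (lemma y (+ k) (+ g) (+ N))
    where
    lemma : ∀ Y K G M → Y ℤ.- K ℤ.* M ≡ (Y ℤ.- (K ℤ.+ G) ℤ.* M) ℤ.+ G ℤ.* M
    lemma = ℤSolver.solve-∀

  ≼-lower : ∀ k {g u v} → u ≼[ g ] lower k v → u ≡ lower (k ℕ.+ g) v
  ≼-lower k {g} {x , z} {_ , y} (above refl eq) = cong (x ,_)
    (trans (cancel z (+ g) (+ N)) (trans (cong (ℤ._- + g ℤ.* + N) (sym eq)) (lemma y (+ k) (+ g) (+ N))))
    where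
    cancel : ∀ Z G M → Z ≡ (Z ℤ.+ G ℤ.* M) ℤ.- G ℤ.* M
    cancel = ℤSolver.solve-∀
    lemma : ∀ Y K G M → (Y ℤ.- K ℤ.* M) ℤ.- G ℤ.* M ≡ Y ℤ.- (K ℤ.+ G) ℤ.* M
    lemma = ℤSolver.solve-∀

  ≼[]-irrefl : ∀ {u g} → u ≼[ g ] u → g ≡ 0
  ≼[]-irrefl {x , y} {g} (above _ eq) = ℤP.+-injective (ℤP.*-cancelʳ-≡ (+ g) (+ 0) (+ N)
    (ℤGroup.∙-cancelˡ y _ _ (trans (sym eq) (sym (ℤP.+-identityʳ y)))))

  -- H is bounded from above only, and a shift by a multiple of N preserves the congruence.
  lower-InH : ∀ k {v} → InH v → InH (lower k v)
  lower-InH k {x , y} ((x<N , N∣) , y≤h) with Signed.∣ᵤ⇒∣ {i = y ℤ.- + (a ℕ.* x)} N∣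
  ... | Signed.divides q eq =
    (x<N , Signed.∣⇒∣ᵤ (Signed.divides (q ℤ.- + k)
      (trans (swap y (+ k ℤ.* + N) (+ (a ℕ.* x))) (trans (cong (ℤ._- + k ℤ.* + N) eq) (factor q (+ k) (+ N)))))) ,
    ℤP.≤-trans (≼⇒≤ {lower k (x , y)} (k , above refl (cancel y (+ k) (+ N)))) y≤h
    where
    swap : ∀ Y K X → (Y ℤ.- K) ℤ.- X ≡ (Y ℤ.- X) ℤ.- K
    swap = ℤSolver.solve-∀
    factor : ∀ Q K M → Q ℤ.* M ℤ.- K ℤ.* M ≡ (Q ℤ.- K) ℤ.* M
    factor = ℤSolver.solve-∀
    cancel : ∀ Y K M → Y ≡ (Y ℤ.- K ℤ.* M) ℤ.+ K ℤ.* M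
    cancel = ℤSolver.solve-∀

  -- Lap cycles stay below the highest lap cycle

  ups : Word → ℕ
  ups []         = 0
  ups (up ∷ l)   = suc (ups l)
  ups (down ∷ l) = ups l

  -- An up-step is a down-step plus N, so the height depends only on the length and the number of
  -- ups. For a lap this forces the number of ups to be b.
  run-height : ∀ v l → proj₂ (run v l) ≡ proj₂ v ℤ.+ (+ ups l ℤ.* + N ℤ.- + length l ℤ.* + b)
  run-height (x , y) [] = sym (ℤP.+-identityʳ y)
  run-height (x , y) (up ∷ l) = trans (run-height (next x , y ℤ.+ + a) l) (lemma y (+ a) (+ b) (+ ups l) (+ length l))
    where
    lemma : ∀ Y A B U L → Y ℤ.+ A ℤ.+ (U ℤ.* (A ℤ.+ B) ℤ.- L ℤ.* B) ≡
      Y ℤ.+ ((+ 1 ℤ.+ U) ℤ.* (A ℤ.+ B) ℤ.- (+ 1 ℤ.+ L) ℤ.* B)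
    lemma = ℤSolver.solve-∀
  run-height (x , y) (down ∷ l) = trans (run-height (next x , y ℤ.- + b) l) (lemma y (+ a) (+ b) (+ ups l) (+ length l))
    where
    lemma : ∀ Y A B U L → Y ℤ.- B ℤ.+ (U ℤ.* (A ℤ.+ B) ℤ.- L ℤ.* B) ≡
      Y ℤ.+ (U ℤ.* (A ℤ.+ B) ℤ.- (+ 1 ℤ.+ L) ℤ.* B)
    lemma = ℤSolver.solve-∀

  LapWord : Word → Set
  LapWord l = length l ≡ N × run origin l ≡ origin

  lap-ups : ∀ {l} → LapWord l → ups l ≡ b
  lap-ups {l} (len , closed) = ℤP.+-injective (ℤP.*-cancelʳ-≡ (+ ups l) (+ b) (+ N)
    (trans (ℤP.i-j≡0⇒i≡j (+ ups l ℤ.* + N) (+ length l ℤ.* + b)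
      (trans (sym (ℤP.+-identityˡ _)) (trans (sym (run-height origin l)) (cong proj₂ closed))))
    (trans (cong (λ z → + z ℤ.* + b) len) (ℤP.*-comm (+ N) (+ b)))))

  origin-InH : InH origin
  origin-InH = (0<N , Signed.∣⇒∣ᵤ {k = + N} (Signed.divides (+ 0) (cong (λ z → + 0 ℤ.- + z) (ℕP.*-zeroʳ a)))) ,
    ℤ.+≤+ z≤n

  -- This is the point reached from the origin after t steps, u of them up. Replacing u by its bound
  -- t gives the rising side of `h`, and replacing it by b gives the falling side.
  hat : ∀ {t u} → t < N → u ≤ t → u ≤ b → InH (t , + u ℤ.* + N ℤ.- + t ℤ.* + b)
  hat {t} {u} t<N u≤t u≤b = (t<N , Signed.∣⇒∣ᵤ (Signed.divides (+ u ℤ.- + t) residue)) , bound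
    where
    y = + u ℤ.* + N ℤ.- + t ℤ.* + b
    residue : y ℤ.- + (a ℕ.* t) ≡ (+ u ℤ.- + t) ℤ.* + N
    residue = trans (cong (λ z → y ℤ.- z) (ℤP.pos-* a t)) (lemma (+ u) (+ t) (+ a) (+ b))
      where
      lemma : ∀ U T A B → U ℤ.* (A ℤ.+ B) ℤ.- T ℤ.* B ℤ.- A ℤ.* T ≡ (U ℤ.- T) ℤ.* (A ℤ.+ B)
      lemma = ℤSolver.solve-∀
    y≤ : ∀ {u′} → u ≤ u′ → y ℤ.≤ + u′ ℤ.* + N ℤ.- + t ℤ.* + b
    y≤ u≤u′ = ℤP.+-monoˡ-≤ (ℤ.- (+ t ℤ.* + b)) (ℤP.*-monoʳ-≤-nonNeg (+ N) (ℤ.+≤+ u≤u′))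
    bound : y ℤ.≤ h t
    bound with t ℕ.≤ᵇ b in eq
    ... | true  = subst (y ℤ.≤_) (trans (lemma (+ t) (+ a) (+ b)) (sym (ℤP.pos-* a t))) (y≤ u≤t)
      where
      lemma : ∀ T A B → T ℤ.* (A ℤ.+ B) ℤ.- T ℤ.* B ≡ A ℤ.* T
      lemma = ℤSolver.solve-∀
    ... | false = subst (y ℤ.≤_) eq′ (y≤ u≤b)
      where
      lemma : ∀ T A B → B ℤ.* (A ℤ.+ B) ℤ.- T ℤ.* B ≡ A ℤ.* B ℤ.- B ℤ.* (T ℤ.- B)
      lemma = ℤSolver.solve-∀
      b≤t : b ≤ t
      b≤t = ℕP.<⇒≤ (ℕP.≰⇒> λ t≤b → subst T eq (ℕP.≤⇒≤ᵇ t≤b))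
      eq′ : + b ℤ.* + N ℤ.- + t ℤ.* + b ≡ + (a ℕ.* b) ℤ.- + (b ℕ.* (t ∸ b))
      eq′ = trans (lemma (+ t) (+ a) (+ b)) (sym (cong₂ ℤ._-_ (ℤP.pos-* a b)
        (trans (ℤP.pos-* b (t ∸ b)) (cong (λ z → + b ℤ.* z) (trans (sym (ℤP.⊖-≥ b≤t)) (sym (ℤP.m-n≡m⊖n t b)))))))

  -- Here t counts the steps already made and u the ups among them. The column has two hypotheses
  -- because it agrees with t until the last step, where it wraps to 0.
  lap-inside′ : ∀ t u v l → (t < N → proj₁ v ≡ t) → (t ≡ N → proj₁ v ≡ 0) → t ℕ.+ length l ≡ N →
    u ≤ t → u ℕ.+ ups l ≡ b → proj₂ v ≡ + u ℤ.* + N ℤ.- + t ℤ.* + b →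
    InH v × Inside (trail v l)
  lap-inside′ t u (x , y) [] _ col len u≤t us eq =
    subst InH (cong₂ _,_ (sym (col t≡N)) (sym (trans eq (trans (cong₂ (λ i j → + i ℤ.* + N ℤ.- + j ℤ.* + b) u≡b t≡N)
      (cancel (+ b) (+ N)))))) origin-InH , []
    where
    t≡N = trans (sym (ℕP.+-identityʳ t)) len
    u≡b = trans (sym (ℕP.+-identityʳ u)) us
    cancel : ∀ B M → B ℤ.* M ℤ.- M ℤ.* B ≡ + 0
    cancel = ℤSolver.solve-∀
  lap-inside′ t u v@(x , y) (d ∷ l) col _ len u≤t us eq = v∈ , (v∈ , proj₁ (continue d us)) ∷ proj₂ (continue d us)
    where
    t<N : t < N
    t<N = subst (t <_) len (ℕP.m<m+n t (s≤s z≤n))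
    v∈ : InH v
    v∈ = subst InH (cong₂ _,_ (sym (col t<N)) (sym eq)) (hat t<N u≤t (subst (u ≤_) us (ℕP.m≤m+n u _)))
    len′ : suc t ℕ.+ length l ≡ N
    len′ = trans (sym (ℕP.+-suc t (length l))) len
    col< : suc t < N → next x ≡ suc t
    col< lt = trans (cong next (col t<N)) (next-< lt)
    col≡ : suc t ≡ N → next x ≡ 0
    col≡ st≡N = trans (cong next (col t<N)) (next-≡ st≡N)
    continue : ∀ d → u ℕ.+ ups (d ∷ l) ≡ b → InH (step v d) × Inside (trail (step v d) l)
    continue up us = lap-inside′ (suc t) (suc u) (step v up) l col< col≡ len′ (s≤s u≤t)
      (trans (sym (ℕP.+-suc u (ups l))) us) (trans (cong (ℤ._+ + a) eq) (lemma (+ u) (+ t) (+ a) (+ b)))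
      where
      lemma : ∀ U T A B → U ℤ.* (A ℤ.+ B) ℤ.- T ℤ.* B ℤ.+ A ≡ (+ 1 ℤ.+ U) ℤ.* (A ℤ.+ B) ℤ.- (+ 1 ℤ.+ T) ℤ.* B
      lemma = ℤSolver.solve-∀
    continue down us = lap-inside′ (suc t) u (step v down) l col< col≡ len′ (ℕP.m≤n⇒m≤1+n u≤t)
      us (trans (cong (ℤ._- + b) eq) (lemma (+ u) (+ t) (+ N) (+ b)))
      where
      lemma : ∀ U T M B → U ℤ.* M ℤ.- T ℤ.* B ℤ.- B ≡ U ℤ.* M ℤ.- (+ 1 ℤ.+ T) ℤ.* B
      lemma = ℤSolver.solve-∀

  lap-inside : ∀ {l} → LapWord l → Inside (trail origin l)
  lap-inside {l} lap = proj₂ (lap-inside′ 0 0 origin l (λ _ → refl) (λ _ → refl) (proj₁ lap) z≤n (lap-ups {l} lap) refl)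

  lower-lap-inside : ∀ k {l} → LapWord l → Inside (trail (weld k) l)
  lower-lap-inside k {l} lap = subst (All _) (sym (trail-lower k origin l)) (AllP.map⁺ (All.map
    (λ { {u , d} (p , q) → lower-InH k p , subst InH (sym (step-lower k u d)) (lower-InH k q) }) (lap-inside {l} lap)))

  lower-lap-closed : ∀ k {l} → LapWord l → run (weld k) l ≡ weld k
  lower-lap-closed k {l} lap = trans (run-lower k origin l) (cong (lower k) (proj₂ lap))

  -- The least gap at which one word runs above another (junk value 0 if their lengths differ)

  need : Word → Word → ℕ
  need (up   ∷ l) (up   ∷ m) = need l m
  need (down ∷ l) (down ∷ m) = need l m
  need (up   ∷ l) (down ∷ m) = ℕ.pred (need l m)
  need (down ∷ l) (up   ∷ m) = suc (need l m)
  need _          _          = 0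

  -- The index is the current gap and the first word is the upper one. Crossing is excluded by the
  -- missing case: at gap 0 the upper word may not go down while the lower goes up.
  data Clear : ℕ → Word → Word → Set where
    []       : ∀ {g} → Clear g [] []
    same     : ∀ {g d l m} → Clear g l m → Clear g (d ∷ l) (d ∷ m)
    apart    : ∀ {g l m} → Clear (suc g) l m → Clear g (up ∷ l) (down ∷ m)
    together : ∀ {g l m} → Clear g l m → Clear (suc g) (down ∷ l) (up ∷ m)

  -- The gap becomes 0 at some moment, possibly at the end; nothing is asked of the words
  -- afterwards.
  data Touch : ℕ → Word → Word → Set where
    here     : ∀ {l m} → Touch 0 l m
    same     : ∀ {g d l m} → Touch g l m → Touch g (d ∷ l) (d ∷ m)
    apart    : ∀ {g l m} → Touch (suc g) l m → Touch g (up ∷ l) (down ∷ m)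
    together : ∀ {g l m} → Touch g l m → Touch (suc g) (down ∷ l) (up ∷ m)

  pred≤⇒≤suc : ∀ {g} n → ℕ.pred n ≤ g → n ≤ suc g
  pred≤⇒≤suc zero    _  = z≤n
  pred≤⇒≤suc (suc n) le = s≤s le

  need-clear : ∀ {g} l m → length l ≡ length m → need l m ≤ g → Clear g l m
  need-clear []         []         _  _        = []
  need-clear (up ∷ l)   (up ∷ m)   eq le       = same (need-clear l m (ℕP.suc-injective eq) le)
  need-clear (down ∷ l) (down ∷ m) eq le       = same (need-clear l m (ℕP.suc-injective eq) le)
  need-clear (up ∷ l)   (down ∷ m) eq le       = apart (need-clear l m (ℕP.suc-injective eq) (pred≤⇒≤suc (need l m) le))
  need-clear (down ∷ l) (up ∷ m)   eq (s≤s le) = together (need-clear l m (ℕP.suc-injective eq) le)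

  need-touch : ∀ l m → length l ≡ length m → Touch (need l m) l m
  need-touch []         []         _  = here
  need-touch (up ∷ l)   (up ∷ m)   eq = same (need-touch l m (ℕP.suc-injective eq))
  need-touch (down ∷ l) (down ∷ m) eq = same (need-touch l m (ℕP.suc-injective eq))
  need-touch (down ∷ l) (up ∷ m)   eq = together (need-touch l m (ℕP.suc-injective eq))
  need-touch (up ∷ l)   (down ∷ m) eq with need l m | need-touch l m (ℕP.suc-injective eq)
  -- The predecessor is truncated here: the needed gap is 0, and words at gap 0 touch at their
  -- start.
  ... | zero  | _ = here
  ... | suc _ | t = apart t

  -- Together with `touch⇒≤need` this makes `need` the only gap at which two words both clear and
  -- touch, which is how the gap is recovered when a stack is taken apart.
  clear⇒need≤ : ∀ {g l m} → Clear g l m → need l m ≤ g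
  clear⇒need≤ []                  = z≤n
  clear⇒need≤ (same {d = up} c)   = clear⇒need≤ c
  clear⇒need≤ (same {d = down} c) = clear⇒need≤ c
  clear⇒need≤ (apart c)           = ℕP.pred-mono-≤ (clear⇒need≤ c)
  clear⇒need≤ (together c)        = s≤s (clear⇒need≤ c)

  touch⇒≤need : ∀ {g l m} → Touch g l m → g ≤ need l m
  touch⇒≤need here                = z≤n
  touch⇒≤need (same {d = up} t)   = touch⇒≤need t
  touch⇒≤need (same {d = down} t) = touch⇒≤need t
  touch⇒≤need (apart t)           = ℕP.pred-mono-≤ (touch⇒≤need t)
  touch⇒≤need (together t)        = s≤s (touch⇒≤need t)

  touch-meet : ∀ {v w g l m} → w ≼[ g ] v → Touch g l m →
    ∃ λ u → u ∈ v ∷ map tgt (trail v l) × u ∈ w ∷ map tgt (trail w m)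
  touch-meet p here with ≼[0]⇒≡ p
  ... | refl = _ , here refl , here refl
  touch-meet p (same {d = d} t) with touch-meet (step-same d p) t
  ... | u , ∈v , ∈w = u , there ∈v , there ∈w
  touch-meet p (apart t) with touch-meet (step-apart p) t
  ... | u , ∈v , ∈w = u , there ∈v , there ∈w
  touch-meet p (together t) with touch-meet (step-together p) t
  ... | u , ∈v , ∈w = u , there ∈v , there ∈w

  -- Targets are compared as well as sources: otherwise an up arrow could count as lying under the
  -- down arrow from the same vertex, and the top lap could not be recognised.
  Under : List Arrow → List Arrow → Set
  Under E F = ∀ {e} → e ∈ E → ∃ λ f → f ∈ F × src e ≼ src f × tgt e ≼ tgt f

  clear-under : ∀ {v w g l m} → w ≼[ g ] v → Clear g l m → Under (trail w m) (trail v l)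
  clear-under p (same {d = d} c) (here refl) = _ , here refl , (_ , p) , (_ , step-same d p)
  clear-under p (apart c)    (here refl) = _ , here refl , (_ , p) , (_ , step-apart p)
  clear-under p (together c) (here refl) = _ , here refl , (_ , p) , (_ , step-together p)
  clear-under p (same {d = d} c) (there e∈) with clear-under (step-same d p) c e∈
  ... | f , f∈ , q = f , there f∈ , q
  clear-under p (apart c) (there e∈) with clear-under (step-apart p) c e∈
  ... | f , f∈ , q = f , there f∈ , q
  clear-under p (together c) (there e∈) with clear-under (step-together p) c e∈
  ... | f , f∈ , q = f , there f∈ , q

  -- Stacks of laps

  stackFrom : ∀ {n} → ℕ → Word → Vec Word n → List Arrow
  stackFrom k l []       = trail (weld k) l
  stackFrom k l (m ∷ ls) = trail (weld k) l ++ stackFrom (k ℕ.+ need l m) m ls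

  stack : ∀ {n} → Vec Word n → List Arrow
  stack []       = []
  stack (l ∷ ls) = stackFrom 0 l ls

  top⊆stackFrom : ∀ {n} k l (ls : Vec Word n) → trail (weld k) l ⊆ stackFrom k l ls
  top⊆stackFrom k l []       = λ e∈ → e∈
  top⊆stackFrom k l (m ∷ ls) = ∈P.∈-++⁺ˡ

  lap-length : ∀ {l m} → LapWord l → LapWord m → length l ≡ length m
  lap-length p q = trans (proj₁ p) (sym (proj₁ q))

  stackFrom-length : ∀ {n} k l (ls : Vec Word n) → LapWord l → VAll LapWord ls →
    length (stackFrom k l ls) ≡ N ℕ.* suc n
  stackFrom-length k l [] lap [] = trans (length-trail (weld k) l) (trans (proj₁ lap) (sym (ℕP.*-identityʳ N)))
  stackFrom-length {suc n} k l (m ∷ ls) lap (lap′ ∷ laps) = trans (ListP.length-++ (trail (weld k) l))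
    (trans (cong₂ ℕ._+_ (trans (length-trail (weld k) l) (proj₁ lap)) (stackFrom-length _ m ls lap′ laps))
      (sym (ℕP.*-suc N (suc n))))

  stackFrom-good : ∀ {n} k l (ls : Vec Word n) → LapWord l → VAll LapWord ls → Good (weld k) (stackFrom k l ls)
  stackFrom-good k l [] lap [] = record
    { inside    = lower-lap-inside k {l} lap
    ; balanced  = cycle-balanced (weld k) l (lower-lap-closed k {l} lap)
    ; connected = λ u∈ → proj₁ (reach-visited (weld k) l (λ e∈ → e∈) (src⊆visited (weld k) l u∈))
    }
  stackFrom-good k l (m ∷ ls) lap (lap′ ∷ laps) = record
    { inside    = AllP.++⁺ (lower-lap-inside k {l} lap) (inside ih)
    ; balanced  = balanced-++ (cycle-balanced (weld k) l (lower-lap-closed k {l} lap)) (balanced ih)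
    ; connected = connected′
    }
    where
    k′ = k ℕ.+ need l m
    ih = stackFrom-good k′ m ls lap′ laps
    E = stackFrom k l (m ∷ ls)
    lower⊆ : stackFrom k′ m ls ⊆ E
    lower⊆ = ∈P.∈-++⁺ʳ (trail (weld k) l)
    -- Follow the upper lap to a meeting point, then the rest of the lower lap, which ends at its
    -- own weld point.
    descend : Reach E (weld k) (weld k′)
    descend with touch-meet (lower-≼ k (need l m) origin) (need-touch l m (lap-length {l} {m} lap lap′))
    ... | u , ∈l , ∈m = reach-trans
      (proj₁ (reach-visited (weld k) l (top⊆stackFrom k l (m ∷ ls)) ∈l))
      (subst (Reach E u) (lower-lap-closed k′ {m} lap′)
        (proj₂ (reach-visited (weld k′) m (lower⊆ ∘ top⊆stackFrom k′ m ls) ∈m)))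
    connected′ : ∀ {u} → u ∈ map src E → Reach E (weld k) u
    connected′ {u} u∈ with arrow∈ u∈
    ... | d , e∈ with ∈P.∈-++⁻ (trail (weld k) l) e∈
    ... | inj₁ ∈l = proj₁ (reach-visited (weld k) l (top⊆stackFrom k l (m ∷ ls)) (src⊆visited (weld k) l (src∈ ∈l)))
    ... | inj₂ ∈s = reach-trans descend (reach-mono lower⊆ (connected ih (src∈ ∈s)))

  stackFrom-under : ∀ {n} k l (ls : Vec Word n) → LapWord l → VAll LapWord ls →
    Under (stackFrom k l ls) (trail (weld k) l)
  stackFrom-under k l [] lap [] e∈ = _ , e∈ , ≼-refl , ≼-refl
  stackFrom-under k l (m ∷ ls) lap (lap′ ∷ laps) e∈ with ∈P.∈-++⁻ (trail (weld k) l) e∈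
  ... | inj₁ ∈l = _ , ∈l , ≼-refl , ≼-refl
  ... | inj₂ ∈s with stackFrom-under (k ℕ.+ need l m) m ls lap′ laps ∈s
  ... | f , f∈ , p , q with clear-under (lower-≼ k (need l m) origin)
                              (need-clear l m (lap-length {l} {m} lap lap′) ℕP.≤-refl) f∈
  ... | f′ , f′∈ , p′ , q′ = f′ , f′∈ , ≼-trans p p′ , ≼-trans q q′

  -- Unstacking: the top lap goes up whenever the stack does

  FollowsTop : List Arrow → V → Word → Set
  FollowsTop E v l = trail v l ⊆ E × (∀ {u} → (u , down) ∈ trail v l → (u , up) ∉ E)

  -- E decides each letter: the word goes up exactly when E contains the up arrow at the current
  -- vertex.
  followsTop-unique : ∀ {E} v l m → length l ≡ length m → FollowsTop E v l → FollowsTop E v m → l ≡ m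
  followsTop-unique v []         []         _  _ _ = refl
  followsTop-unique v (up ∷ l)   (down ∷ m) _  (l⊆ , _)   (_ , m-top) = contradiction (l⊆ (here refl)) (m-top (here refl))
  followsTop-unique v (down ∷ l) (up ∷ m)   _  (_ , l-top) (m⊆ , _)   = contradiction (m⊆ (here refl)) (l-top (here refl))
  followsTop-unique v (up ∷ l)   (up ∷ m)   eq (l⊆ , l-top) (m⊆ , m-top) = cong (up ∷_)
    (followsTop-unique _ l m (ℕP.suc-injective eq) (l⊆ ∘ there , l-top ∘ there) (m⊆ ∘ there , m-top ∘ there))
  followsTop-unique v (down ∷ l) (down ∷ m) eq (l⊆ , l-top) (m⊆ , m-top) = cong (down ∷_)
    (followsTop-unique _ l m (ℕP.suc-injective eq) (l⊆ ∘ there , l-top ∘ there) (m⊆ ∘ there , m-top ∘ there))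

  stackFrom-top : ∀ {n} k l (ls : Vec Word n) → LapWord l → VAll LapWord ls → FollowsTop (stackFrom k l ls) (weld k) l
  stackFrom-top k l ls lap laps = top⊆stackFrom k l ls , top
    where
    top : ∀ {u} → (u , down) ∈ trail (weld k) l → (u , up) ∉ stackFrom k l ls
    top {u} down∈ up∈ with stackFrom-under k l ls lap laps up∈
    ... | f , f∈ , p , q with trail-column-injective (weld k) l (ℕP.≤-reflexive (proj₁ lap)) f∈ down∈ (sym (column (proj₂ p)))
    ... | refl = up⋠down {u} q

  weld∈trail : ∀ k {l} → LapWord l → ∃ λ d → (weld k , d) ∈ trail (weld k) l
  weld∈trail k {[]}    (len , _) = contradiction len (ℕP.<⇒≢ 0<N)
  weld∈trail k {d ∷ l} _         = d , here refl

  stackFrom-weld : ∀ {n} k l (ls : Vec Word n) → LapWord l → VAll LapWord ls →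
    ∀ {v} → v ∈ map src (stackFrom k l ls) → proj₁ v ≡ 0 → v ≼ weld k
  stackFrom-weld k l ls lap laps v∈ v≡0 with arrow∈ v∈
  ... | d , e∈ with stackFrom-under k l ls lap laps e∈ | weld∈trail k {l} lap
  ... | f , f∈ , p , _ | e , weld∈
    with trail-column-injective (weld k) l (ℕP.≤-reflexive (proj₁ lap)) f∈ weld∈ (trans (sym (column (proj₂ p))) v≡0)
  ... | refl = p

  weld∈stackFrom : ∀ {n} k l (ls : Vec Word n) → LapWord l → weld k ∈ map src (stackFrom k l ls)
  weld∈stackFrom k l ls lap = src∈ (top⊆stackFrom k l ls (proj₂ (weld∈trail k {l} lap)))

  -- The depth is the position of the highest weld point in the stack, the top word is fixed by E,
  -- and the top lap then cancels. The depths k and k′ are not assumed equal, because after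
  -- cancelling they depend on the next words, which are not yet known to agree.
  stackFrom-injective : ∀ {n} k l (ls : Vec Word n) k′ l′ (ls′ : Vec Word n) →
    LapWord l → VAll LapWord ls → LapWord l′ → VAll LapWord ls′ →
    stackFrom k l ls ↭ stackFrom k′ l′ ls′ → l ≡ l′ × ls ≡ ls′
  stackFrom-injective k l ls k′ l′ ls′ lap laps lap′ laps′ p
    with weld-injective {k} {k′} (≼-antisym
      (stackFrom-weld k′ l′ ls′ lap′ laps′ (↭P.∈-resp-↭ (↭P.map⁺ src p) (weld∈stackFrom k l ls lap)) refl)
      (stackFrom-weld k l ls lap laps (↭P.∈-resp-↭ (↭P.map⁺ src (↭-sym p)) (weld∈stackFrom k′ l′ ls′ lap′)) refl))
  ... | refl with followsTop-unique (weld k) l l′ (lap-length {l} {l′} lap lap′) (stackFrom-top k l ls lap laps)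
                    (↭P.∈-resp-↭ (↭-sym p) ∘ proj₁ top′ , λ down∈ → proj₂ top′ down∈ ∘ ↭P.∈-resp-↭ p)
    where top′ = stackFrom-top k l′ ls′ lap′ laps′
  stackFrom-injective k l []       k l []         lap laps lap′ laps′ p | refl | refl = refl , refl
  stackFrom-injective k l (m ∷ ls) k l (m′ ∷ ls′) lap (lap₁ ∷ laps) lap′ (lap₁′ ∷ laps′) p | refl | refl
    with stackFrom-injective (k ℕ.+ need l m) m ls (k ℕ.+ need l m′) m′ ls′ lap₁ laps lap₁′ laps′
           (++-cancelˡ-↭ (trail (weld k) l) p)
  ... | refl , refl = refl , refl

  stack-injective : ∀ {n} (ls ls′ : Vec Word n) → VAll LapWord ls → VAll LapWord ls′ → stack ls ↭ stack ls′ → ls ≡ ls′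
  stack-injective []       []         _            _              _ = refl
  stack-injective (l ∷ ls) (l′ ∷ ls′) (lap ∷ laps) (lap′ ∷ laps′) p
    with stackFrom-injective 0 l ls 0 l′ ls′ lap laps lap′ laps′ p
  ... | refl , refl = refl

  stack-good : ∀ {n} (ls : Vec Word n) → VAll LapWord ls → Good origin (stack ls)
  stack-good []       []           = record { inside = [] ; balanced = ↭-refl ; connected = λ () }
  stack-good (l ∷ ls) (lap ∷ laps) = stackFrom-good 0 l ls lap laps

  stack-length : ∀ {n} (ls : Vec Word n) → VAll LapWord ls → length (stack ls) ≡ N ℕ.* n
  stack-length []       []           = sym (ℕP.*-zeroʳ N)
  stack-length (l ∷ ls) (lap ∷ laps) = stackFrom-length 0 l ls lap laps

  -- Runs along the highest vertices of a balanced multiset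

  Max : List Arrow → V → Set
  Max E v = v ∈ map src E × (∀ {u} → u ∈ map src E → proj₁ u ≡ proj₁ v → u ≼ v)

  -- Maximality is carried at the last vertex too: a run of N steps from a weld point closes up
  -- because both its ends are highest in column 0.
  data TopRun (E : List Arrow) : V → Word → Set where
    []   : ∀ {v} → Max E v → TopRun E v []
    cons : ∀ {v d l} → Max E v → (v , d) ∈ E → (d ≡ down → (v , up) ∉ E) →
           TopRun E (step v d) l → TopRun E v (d ∷ l)

  topRun-start : ∀ {E v l} → TopRun E v l → Max E v
  topRun-start ([] max)         = max
  topRun-start (cons max _ _ _) = max

  topRun-end : ∀ {E v l} → TopRun E v l → Max E (run v l)
  topRun-end ([] max)       = max
  topRun-end (cons _ _ _ t) = topRun-end t

  topRun-⊆ : ∀ {E v l} → TopRun E v l → All (_∈ E) (trail v l)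
  topRun-⊆ ([] _)          = []
  topRun-⊆ (cons _ e∈ _ t) = e∈ ∷ topRun-⊆ t

  max-unique : ∀ {E u v} → Max E u → Max E v → proj₁ u ≡ proj₁ v → u ≡ v
  max-unique (u∈ , u-max) (v∈ , v-max) eq = ≼-antisym (v-max u∈ eq) (u-max v∈ (sym eq))

  src-InH : ∀ {E u} → Inside E → u ∈ map src E → InH u
  src-InH ins u∈ with arrow∈ u∈
  ... | d , e∈ = proj₁ (All.lookup ins e∈)

  column-< : ∀ {E u} → Inside E → u ∈ map src E → proj₁ u < N
  column-< ins u∈ = proj₁ (proj₁ (src-InH ins u∈))

  module _ {E : List Arrow} (ins : Inside E) (bal : Balancedᴸ E) where

    -- By balance a source in the next column is the target of some arrow of E, which leaves a
    -- vertex at or below v. It could end above the step from v only by going up from v itself while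
    -- the step goes down, and `top` excludes that.
    max-step : ∀ {v d} → Max E v → (v , d) ∈ E → (d ≡ down → (v , up) ∉ E) → Max E (step v d)
    max-step {v} {d} (v∈ , v-max) e∈ top = ↭P.∈-resp-↭ (↭-sym bal) (tgt∈ e∈) , step-max
      where
      step-max : ∀ {z} → z ∈ map src E → proj₁ z ≡ proj₁ (step v d) → z ≼ step v d
      step-max z∈ col with ∈P.∈-map⁻ tgt (↭P.∈-resp-↭ bal z∈)
      ... | (u , c) , f∈ , refl
        with step-mono (v-max (src∈ f∈) (next-injective (column-< ins (src∈ f∈)) (column-< ins v∈)
               (trans (sym (step-column u c)) (trans col (step-column v d))))) c d
      ... | inj₁ le                   = le
      ... | inj₂ (refl , refl , refl) = contradiction f∈ (top refl)

    topRun : ∀ n v → Max E v → ∃ λ l → length l ≡ n × TopRun E v l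
    topRun zero    v max = [] , refl , [] max
    topRun (suc n) v max with (v , up) ∈A? E
    ... | yes up∈ with topRun n (step v up) (max-step max up∈ λ ())
    ...   | l , len , t = up ∷ l , cong suc len , cons max up∈ (λ ()) t
    topRun (suc n) v max | no up∉ with arrow∈ (proj₁ max)
    ... | up , up∈ = contradiction up∈ up∉
    ... | down , down∈ with topRun n (step v down) (max-step max down∈ λ _ → up∉)
    ...   | l , len , t = down ∷ l , cong suc len , cons max down∈ (λ _ → up∉) t

    column-max : ∀ {u} us → u ∈ map src E → us ⊆ map src E →
      ∃ λ v → v ∈ map src E × u ≼ v × (∀ {w} → w ∈ us → proj₁ w ≡ proj₁ u → w ≼ v)
    column-max {u} [] u∈ us⊆ = u , u∈ , ≼-refl , λ ()
    column-max {u} (w ∷ us) u∈ us⊆ with column-max us u∈ (us⊆ ∘ there)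
    ... | v , v∈ , u≼v , v-max with proj₁ w ℕ.≟ proj₁ u
    ... | no  w≢u = v , v∈ , u≼v , λ { (here refl) eq → contradiction eq w≢u ; (there z∈) eq → v-max z∈ eq }
    ... | yes w≡u with ≼-total (proj₁ (src-InH ins (us⊆ (here refl)))) (proj₁ (src-InH ins v∈))
                         (trans w≡u (column (proj₂ u≼v)))
    ...   | inj₁ w≼v = v , v∈ , u≼v , λ { (here refl) _ → w≼v ; (there z∈) eq → v-max z∈ eq }
    ...   | inj₂ v≼w = w , us⊆ (here refl) , ≼-trans u≼v v≼w ,
      λ { (here refl) _ → ≼-refl ; (there z∈) eq → ≼-trans (v-max z∈ eq) v≼w }

    -- A source in column 0 has to be produced from an arbitrary one: the run from the highest
    -- source of column x arrives there after N - x steps.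
    weld-max : ∀ {u} → u ∈ map src E → ∃ λ w → proj₁ w ≡ 0 × Max E w
    weld-max {u} u∈ with column-max (map src E) u∈ (λ z∈ → z∈)
    ... | v , v∈ , u≼v , v-max
      with topRun (N ∸ proj₁ v) v (v∈ , λ z∈ eq → v-max z∈ (trans eq (sym (column (proj₂ u≼v)))))
    ... | l , len , t = run v l ,
      run-column v l (column-< ins v∈) (trans (cong (proj₁ v ℕ.+_) len) (ℕP.m+[n∸m]≡n (ℕP.<⇒≤ (column-< ins v∈)))) ,
      topRun-end t

  topRun-closed : ∀ {E k l} → length l ≡ N → TopRun E (weld k) l → run (weld k) l ≡ weld k
  topRun-closed {k = k} {l} len t = max-unique (topRun-end t) (topRun-start t) (run-column (weld k) l 0<N len)

  topRun-lap : ∀ {E k l} → length l ≡ N → TopRun E (weld k) l → LapWord l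
  topRun-lap {k = k} {l} len t = len , lower-injective k (trans (sym (run-lower k origin l)) (topRun-closed {k = k} len t))

  topRun-clear : ∀ {E E′ v w g l m} → E′ ⊆ E → length l ≡ length m → TopRun E v l → TopRun E′ w m →
    w ≼[ g ] v → Clear g l m
  topRun-clear sub len ([] _) ([] _) p = []
  topRun-clear sub len (cons {d = up} _ _ _ s) (cons {d = up} _ _ _ t) p =
    same (topRun-clear sub (ℕP.suc-injective len) s t (step-same up p))
  topRun-clear sub len (cons {d = down} _ _ _ s) (cons {d = down} _ _ _ t) p =
    same (topRun-clear sub (ℕP.suc-injective len) s t (step-same down p))
  topRun-clear sub len (cons {d = up} _ _ _ s) (cons {d = down} _ _ _ t) p =
    apart (topRun-clear sub (ℕP.suc-injective len) s t (step-apart p))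
  topRun-clear {g = suc g} sub len (cons {d = down} _ _ _ s) (cons {d = up} _ _ _ t) p =
    together (topRun-clear sub (ℕP.suc-injective len) s t (step-together p))
  -- The forbidden crossing: the up arrow of the lower run lies in E, so the upper run should have
  -- taken it.
  topRun-clear {g = zero} sub len (cons {d = down} _ _ top _) (cons {d = up} _ up∈ _ _) p with ≼[0]⇒≡ p
  ... | refl = contradiction (sub up∈) (top refl)

  -- Squeeze: where a vertex u of the upper lap is a source of E′, the lower run is at or above u by
  -- maximality and at or below u by clearness. Hence the gap is 0 there.
  clear-touch : ∀ {E′ v w g l m u} → Clear g l m → TopRun E′ w m → w ≼[ g ] v →
    u ∈ map src (trail v l) → u ∈ map src E′ → Touch g l m × u ∈ map src (trail w m)
  clear-touch {v = v} {w} {g} {d ∷ l} {c ∷ m} cl (cons max _ _ _) p (here refl) u∈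
    with ≼-antisym (g , p) (proj₂ max u∈ (sym (column p)))
  ... | refl with ≼[]-irrefl p
  ... | refl = here , here refl
  clear-touch (same {d = d} cl) (cons _ _ _ t) p (there u∈l) u∈ with clear-touch cl t (step-same d p) u∈l u∈
  ... | touch , u∈m = same touch , there u∈m
  clear-touch (apart cl) (cons _ _ _ t) p (there u∈l) u∈ with clear-touch cl t (step-apart p) u∈l u∈
  ... | touch , u∈m = apart touch , there u∈m
  clear-touch (together cl) (cons _ _ _ t) p (there u∈l) u∈ with clear-touch cl t (step-together p) u∈l u∈
  ... | touch , u∈m = together touch , there u∈m

  weld-below : ∀ {E E′ u} k → Max E (weld k) → E′ ⊆ E → Inside E′ → Balancedᴸ E′ → u ∈ map src E′ →
    ∃ λ g → Max E′ (weld (k ℕ.+ g))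
  weld-below {E′ = E′} k max sub ins bal u∈ with weld-max ins bal u∈
  ... | w , w≡0 , w-max with proj₂ max (src∈ (sub (proj₂ (arrow∈ (proj₁ w-max))))) w≡0
  ... | g , w≼ = g , subst (Max E′) (≼-lower k {v = origin} w≼) w-max

  -- Peeling the laps off a good multiset

  record Unstacked (n k : ℕ) (l : Word) (E : List Arrow) : Set where
    field
      laps    : Vec Word n
      areLaps : VAll LapWord laps
      stacked : stackFrom k l laps ↭ E

  length≡0 : {A : Set} {xs : List A} → length xs ≡ 0 → xs ≡ []
  length≡0 {xs = []} _ = refl

  nonempty : {A : Set} {n : ℕ} (xs : List A) → length xs ≡ N ℕ.* suc n → ∃ λ x → x ∈ xs
  nonempty {n = n} [] eq = contradiction (trans eq (ℕP.*-suc N n)) (ℕP.<⇒≢ (ℕP.≤-trans 0<N (ℕP.m≤m+n N _)))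
  nonempty (x ∷ xs) _ = x , here refl

  module Peel {E E′ : List Arrow} {k : ℕ} {l : Word} (good : Good (weld k) E) (len : length l ≡ N)
              (top : TopRun E (weld k) l) (split : E ↭ trail (weld k) l ++ E′) where

    closed : run (weld k) l ≡ weld k
    closed = topRun-closed {k = k} len top

    bal′ : Balancedᴸ E′
    bal′ = ↭P.drop-∷ (subst (λ z → weld k ∷ map src E′ ↭ z ∷ map tgt E′) closed
      (trail-flow (weld k) l E′ (balanced-resp-↭ split (balanced good))))

    E′⊆E : E′ ⊆ E
    E′⊆E e∈ = ↭P.∈-resp-↭ (↭-sym split) (∈P.∈-++⁺ʳ (trail (weld k) l) e∈)

    ins′ : Inside E′
    ins′ = All.tabulate λ e∈ → All.lookup (inside good) (E′⊆E e∈)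

    next-lap : ∀ {u} → u ∈ map src E′ → ∃₂ λ g m → length m ≡ N × TopRun E′ (weld (k ℕ.+ g)) m
    next-lap u∈ =
      let g , max          = weld-below k (topRun-start top) E′⊆E ins′ bal′ u∈
          m , lenm , top′ = topRun ins′ bal′ N (weld (k ℕ.+ g)) max
      in g , m , lenm , top′

    module Next {g : ℕ} {m : Word} (lenm : length m ≡ N) (top′ : TopRun E′ (weld (k ℕ.+ g)) m) where

      clear : Clear g l m
      clear = topRun-clear E′⊆E (trans len (sym lenm)) top top′ (lower-≼ k g origin)

      -- Contact of the two laps and connectedness of E′ come from the same event: whenever a walk
      -- in E leaves the top lap along E′, it does so at a vertex of both laps, which m reaches
      -- inside E′.
      Joined : V → Set
      Joined u = Touch g l m × Reach E′ (weld (k ℕ.+ g)) u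

      join : ∀ {u} → u ∈ map src (trail (weld k) l) ⊎ Joined u → u ∈ map src E′ → Joined u
      join (inj₂ joined) _ = joined
      join (inj₁ u∈l) u∈E′ with clear-touch clear top′ (lower-≼ k g origin) u∈l u∈E′
      ... | touch , u∈m = touch ,
        proj₁ (reach-visited (weld (k ℕ.+ g)) m (All.lookup (topRun-⊆ top′)) (src⊆visited (weld (k ℕ.+ g)) m u∈m))

      -- An arrow of E′ can leave the top lap only where the laps l and m meet.
      follow : ∀ {z} → Reach E (weld k) z → z ∈ map src (trail (weld k) l) ⊎ Joined z
      follow stop = inj₁ (src∈ (proj₂ (weld∈trail k {l} (topRun-lap {k = k} len top))))
      follow (r ▻ f∈) with ∈P.∈-++⁻ (trail (weld k) l) (↭P.∈-resp-↭ split f∈)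
      ... | inj₁ ∈l = inj₁ (↭P.∈-resp-↭ (↭-sym (cycle-balanced (weld k) l closed)) (tgt∈ ∈l))
      ... | inj₂ ∈E′ with join (follow r) (src∈ ∈E′)
      ...   | touch , r′ = inj₂ (touch , r′ ▻ ∈E′)

      joined : ∀ {u} → u ∈ map src E′ → Joined u
      joined u∈ = join (follow (connected good (src∈ (E′⊆E (proj₂ (arrow∈ u∈)))))) u∈

      good′ : Good (weld (k ℕ.+ g)) E′
      good′ = record { inside = ins′ ; balanced = bal′ ; connected = λ u∈ → proj₂ (joined u∈) }

      g≡need : g ≡ need l m
      g≡need = ℕP.≤-antisym (touch⇒≤need (proj₁ (joined (proj₁ (topRun-start top′))))) (clear⇒need≤ clear)

  peel-length : ∀ {E E′} k l {n} → length l ≡ N → E ↭ trail (weld k) l ++ E′ → length E ≡ N ℕ.* suc n →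
    length E′ ≡ N ℕ.* n
  peel-length {E} {E′} k l {n} len split lenE = ℕP.+-cancelˡ-≡ N _ _ (begin
    N ℕ.+ length E′                          ≡⟨ cong (ℕ._+ length E′) (sym (trans (length-trail (weld k) l) len)) ⟩
    length (trail (weld k) l) ℕ.+ length E′  ≡⟨ sym (ListP.length-++ (trail (weld k) l)) ⟩
    length (trail (weld k) l ++ E′)          ≡⟨ sym (↭P.↭-length split) ⟩
    length E                                 ≡⟨ lenE ⟩
    N ℕ.* suc n                              ≡⟨ ℕP.*-suc N n ⟩
    N ℕ.+ N ℕ.* n                            ∎)
    where open ≡-Reasoning

  unstackFrom : ∀ n k l E → Good (weld k) E → length E ≡ N ℕ.* suc n → length l ≡ N → TopRun E (weld k) l →
    Unstacked n k l E
  unstackRest : ∀ n k l E E′ → Good (weld k) E → length E′ ≡ N ℕ.* n → length l ≡ N → TopRun E (weld k) l →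
    E ↭ trail (weld k) l ++ E′ → Unstacked n k l E
  unstackNext : ∀ n k l E E′ → Good (weld k) E → length E′ ≡ N ℕ.* suc n → length l ≡ N → TopRun E (weld k) l →
    E ↭ trail (weld k) l ++ E′ → (∃₂ λ g m → length m ≡ N × TopRun E′ (weld (k ℕ.+ g)) m) → Unstacked (suc n) k l E

  unstackFrom n k l E good lenE len top
    with Unique⊆⇒↭++ (trail-unique (weld k) l (ℕP.≤-reflexive len)) (topRun-⊆ top)
  ... | E′ , split = unstackRest n k l E E′ good (peel-length k l len split lenE) len top split

  unstackRest zero k l E E′ good eq len top split with length≡0 {xs = E′} (trans eq (ℕP.*-zeroʳ N))
  ... | refl = record
    { laps = [] ; areLaps = [] ; stacked = ↭-sym (↭-trans split (↭-reflexive (ListP.++-identityʳ (trail (weld k) l)))) }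
  unstackRest (suc n) k l E E′ good eq len top split = unstackNext n k l E E′ good eq len top split
    (Peel.next-lap {E} {E′} {k} {l} good len top split (src∈ (proj₂ (nonempty E′ eq))))

  unstackNext n k l E E′ good eq len top split (g , m , lenm , top′) = record
    { laps    = m ∷ laps
    ; areLaps = topRun-lap {k = k ℕ.+ g} {m} lenm top′ ∷ areLaps
    ; stacked = ↭-trans (↭P.++⁺ˡ (trail (weld k) l) (subst (λ h → stackFrom (k ℕ.+ h) m laps ↭ E′) g≡need stacked)) (↭-sym split)
    }
    where
    open Peel.Next {E} {E′} {k} {l} good len top split {g} {m} lenm top′
    open Unstacked (unstackFrom n (k ℕ.+ g) m E′ good′ eq lenm top′)

  -- Connectedness of a nonempty multiset puts the origin among its sources, so the first lap has
  -- depth 0.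
  reach-start : ∀ {E o u} → Reach E o u → u ∈ map src E → o ∈ map src E
  reach-start stop     u∈ = u∈
  reach-start (r ▻ e∈) _  = reach-start r (src∈ e∈)

  unstack : ∀ n E → Good origin E → length E ≡ N ℕ.* n →
    ∃ λ (ls : Vec Word n) → VAll LapWord ls × stack ls ↭ E
  unstack zero E good eq with length≡0 {xs = E} (trans eq (ℕP.*-zeroʳ N))
  ... | refl = [] , [] , ↭-refl
  unstack (suc n) E good eq with nonempty E eq
  ... | e , e∈ with topRun (inside good) (balanced good) N origin (origin∈ , origin-max)
    where
    origin∈ : origin ∈ map src E
    origin∈ = reach-start (connected good (src∈ e∈)) (src∈ e∈)
    origin-max : ∀ {u} → u ∈ map src E → proj₁ u ≡ 0 → u ≼ origin
    origin-max u∈ u≡0 with src-InH (inside good) u∈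
    ... | u∈H with ≼-total (proj₁ u∈H) (proj₁ origin-InH) u≡0
    ... | inj₁ u≼ = u≼
    ... | inj₂ ≼u = subst (_≼ origin) (sym (origin-top ≼u u∈H)) ≼-refl
  ... | l , len , top = l ∷ laps , topRun-lap {k = 0} {l} len top ∷ areLaps , stacked
    where open Unstacked (unstackFrom n 0 l E good eq len top)

  open Counting _≟A_ using (count; count-∷-≡; count-∷-≢; count-++; count-↭; count>0⇒∈; ∈⇒count>0; ∉⇒count≡0; count-≗⇒↭; sum-count)
  module #V = Counting _≟V_

  -- Paths as words

  visits : V → Word → List V
  visits v l = map tgt (trail v l)

  -- Up and down from one vertex never end at the same vertex, so the vertex sequence determines the
  -- directions.
  visits-injective : ∀ v l m → visits v l ≡ visits v m → l ≡ m
  visits-injective v []      []      _  = refl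
  visits-injective v (d ∷ l) (e ∷ m) eq with step-injectiveʳ v d e (ListP.∷-injectiveˡ eq)
  ... | refl = cong (d ∷_) (visits-injective (step v d) l m (ListP.∷-injectiveʳ eq))

  linkedWord : ∀ v vs → Linked Edge (v ∷ vs) → ∃ λ l → vs ≡ visits v l
  linkedWord v []       _                 = [] , refl
  linkedWord v (w ∷ vs) ((d , refl) ∷ link) with linkedWord w vs link
  ... | l , eq = d ∷ l , cong (w ∷_) eq

  pathWord : Path → Word
  pathWord p = proj₁ (linkedWord (start p) (rest p) (edges p))

  rest-visits : ∀ p → rest p ≡ visits (start p) (pathWord p)
  rest-visits p = proj₂ (linkedWord (start p) (rest p) (edges p))

  visits-linked : ∀ v l → Linked Edge (v ∷ visits v l)
  visits-linked v []      = [-]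
  visits-linked v (d ∷ l) = (d , refl) ∷ visits-linked (step v d) l

  lastV-visits : ∀ v l → lastV v (visits v l) ≡ run v l
  lastV-visits v []      = refl
  lastV-visits v (d ∷ l) = lastV-visits (step v d) l

  length-visits : ∀ v l → length (visits v l) ≡ length l
  length-visits v l = trans (ListP.length-map tgt (trail v l)) (length-trail v l)

  inside-visits : ∀ v l → InH v → Inside (trail v l) → All InH (v ∷ visits v l)
  inside-visits v l v∈ ins = v∈ ∷ AllP.map⁺ (All.map proj₂ ins)

  visits-inside : ∀ v l → All InH (v ∷ visits v l) → Inside (trail v l)
  visits-inside v []      _         = []
  visits-inside v (d ∷ l) (v∈ ∷ vs∈) = (v∈ , All.head vs∈) ∷ visits-inside (step v d) l vs∈

  wordPath : ∀ v l → InH v → Inside (trail v l) → Path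
  wordPath v l v∈ ins = path v (visits v l) (inside-visits v l v∈ ins) (visits-linked v l)

  pathWord-wordPath : ∀ v l v∈ ins → pathWord (wordPath v l v∈ ins) ≡ l
  pathWord-wordPath v l v∈ ins = visits-injective v _ l (sym (rest-visits (wordPath v l v∈ ins)))

  path-inside : ∀ p → Inside (trail (start p) (pathWord p))
  path-inside p = visits-inside _ _ (subst (λ vs → All InH (start p ∷ vs)) (rest-visits p) (inH p))

  endV-run : ∀ p → endV p ≡ run (start p) (pathWord p)
  endV-run p = trans (cong (lastV (start p)) (rest-visits p)) (lastV-visits (start p) (pathWord p))

  len-word : ∀ p → len p ≡ length (pathWord p)
  len-word p = trans (cong length (rest-visits p)) (length-visits (start p) (pathWord p))

  toStep : Arrow → V × V
  toStep e = src e , tgt e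

  steps-visits : ∀ v l → steps v (visits v l) ≡ map toStep (trail v l)
  steps-visits v []      = refl
  steps-visits v (d ∷ l) = cong (_ ∷_) (steps-visits (step v d) l)

  steps-path : ∀ p → steps (start p) (rest p) ≡ map toStep (trail (start p) (pathWord p))
  steps-path p = trans (cong (steps (start p)) (rest-visits p)) (steps-visits (start p) (pathWord p))

  stepIs? : ∀ u d (s : V × V) → Dec (proj₁ s ≡ u × proj₂ s ≡ step u d)
  stepIs? u d s = (proj₁ s ≟V u) ×-dec (proj₂ s ≟V step u d)

  -- `uses` recognises an edge by its two end vertices, and these determine its direction.
  count-steps : ∀ u d E → length (filter (stepIs? u d) (map toStep E)) ≡ count (u , d) E
  count-steps u d [] = refl
  count-steps u d (e ∷ E) with e ≟A (u , d)
  ... | yes refl = trans (cong length (ListP.filter-accept (stepIs? u d) {toStep e} (refl , refl)))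
                         (cong suc (count-steps u d E))
  ... | no e≢    = trans (cong length (ListP.filter-reject (stepIs? u d) {toStep e} differ))
                         (count-steps u d E)
    where
    differ : ¬ (src e ≡ u × tgt e ≡ step u d)
    differ (refl , eq) = e≢ (cong (u ,_) (step-injectiveʳ u _ d eq))

  uses-count : ∀ p u d → uses p u d ≡ count (u , d) (trail (start p) (pathWord p))
  uses-count p u d = trans (cong (λ ss → length (filter (stepIs? u d) ss)) (steps-path p))
    (count-steps u d (trail (start p) (pathWord p)))

  dirOf-toStep : ∀ e → dirOf (toStep e) ≡ proj₂ e
  dirOf-toStep (u , d) with step u d ≟V step u down
  ... | yes eq = sym (step-injectiveʳ u d down eq)
  dirOf-toStep (u , up)   | no _  = refl
  dirOf-toStep (u , down) | no ne = contradiction refl ne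

  dirsAt : V → List Arrow → List Dir
  dirsAt u E = map dirOf (filter (λ s → proj₁ s ≟V u) (map toStep E))

  dirsAt-∷-≡ : ∀ u d E → dirsAt u ((u , d) ∷ E) ≡ d ∷ dirsAt u E
  dirsAt-∷-≡ u d E = trans (cong (map dirOf) (ListP.filter-accept (λ s → proj₁ s ≟V u) {toStep (u , d)} refl))
    (cong (_∷ dirsAt u E) (dirOf-toStep (u , d)))

  dirsAt-∷-≢ : ∀ {u v} d E → v ≢ u → dirsAt u ((v , d) ∷ E) ≡ dirsAt u E
  dirsAt-∷-≢ {u} {v} d E v≢u = cong (map dirOf) (ListP.filter-reject (λ s → proj₁ s ≟V u) {toStep (v , d)} v≢u)

  allUp⇒down∉ : ∀ {u} E → All (_≡ up) (dirsAt u E) → (u , down) ∉ E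
  allUp⇒down∉ {u} ((u , down) ∷ E) ups (here refl) with subst (All (_≡ up)) (dirsAt-∷-≡ u down E) ups
  ... | () ∷ _
  allUp⇒down∉ {u} ((v , d) ∷ E) ups (there down∈) = allUp⇒down∉ E (tail (v ≟V u)) down∈
    where
    tail : Dec (v ≡ u) → All (_≡ up) (dirsAt u E)
    tail (yes refl) = All.tail (subst (All (_≡ up)) (dirsAt-∷-≡ u d E) ups)
    tail (no v≢u)   = subst (All (_≡ up)) (dirsAt-∷-≢ d E v≢u) ups

  down∉⇒allUp : ∀ {u} E → (u , down) ∉ E → All (_≡ up) (dirsAt u E)
  down∉⇒allUp [] _ = []
  down∉⇒allUp {u} ((v , d) ∷ E) down∉ = extend d (v ≟V u) down∉
    where
    extend : ∀ d → Dec (v ≡ u) → (u , down) ∉ (v , d) ∷ E → All (_≡ up) (dirsAt u ((v , d) ∷ E))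
    extend d    (no v≢u)   ∉E = subst (All (_≡ up)) (sym (dirsAt-∷-≢ d E v≢u)) (down∉⇒allUp E (∉E ∘ there))
    extend up   (yes refl) ∉E = subst (All (_≡ up)) (sym (dirsAt-∷-≡ u up E)) (refl ∷ down∉⇒allUp E (∉E ∘ there))
    extend down (yes refl) ∉E = contradiction (here refl) ∉E

  allUp⇒downsBeforeUps : ∀ {ds} → All (_≡ up) ds → DownsBeforeUps ds
  allUp⇒downsBeforeUps []          = tt
  allUp⇒downsBeforeUps (refl ∷ ps) = ps

  downsBeforeUps-tail : ∀ {u} v d E → DownsBeforeUps (dirsAt u ((v , d) ∷ E)) → DownsBeforeUps (dirsAt u E)
  downsBeforeUps-tail {u} v d E = go d (v ≟V u)
    where
    go : ∀ d → Dec (v ≡ u) → DownsBeforeUps (dirsAt u ((v , d) ∷ E)) → DownsBeforeUps (dirsAt u E)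
    go d    (no v≢u)   dbu = subst DownsBeforeUps (dirsAt-∷-≢ d E v≢u) dbu
    go up   (yes refl) dbu = allUp⇒downsBeforeUps (subst DownsBeforeUps (dirsAt-∷-≡ u up E) dbu)
    go down (yes refl) dbu = subst DownsBeforeUps (dirsAt-∷-≡ u down E) dbu

  downsBeforeUps⇒downsFirst : ∀ E → (∀ u → DownsBeforeUps (dirsAt u E)) → DownsFirstᴸ E
  downsBeforeUps⇒downsFirst []               dbu = []
  downsBeforeUps⇒downsFirst ((v , down) ∷ E) dbu =
    down∷ (downsBeforeUps⇒downsFirst E λ u → downsBeforeUps-tail v down E (dbu u))
  downsBeforeUps⇒downsFirst ((v , up) ∷ E)   dbu =
    up∷ (allUp⇒down∉ E (subst DownsBeforeUps (dirsAt-∷-≡ v up E) (dbu v)))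
        (downsBeforeUps⇒downsFirst E λ u → downsBeforeUps-tail v up E (dbu u))

  downsFirst⇒downsBeforeUps : ∀ {E} → DownsFirstᴸ E → ∀ u → DownsBeforeUps (dirsAt u E)
  downsFirst⇒downsBeforeUps [] u = tt
  downsFirst⇒downsBeforeUps (down∷ {v} {E} df) u = go (v ≟V u)
    where
    go : Dec (v ≡ u) → DownsBeforeUps (dirsAt u ((v , down) ∷ E))
    go (yes refl) = subst DownsBeforeUps (sym (dirsAt-∷-≡ v down E)) (downsFirst⇒downsBeforeUps df u)
    go (no v≢u)   = subst DownsBeforeUps (sym (dirsAt-∷-≢ down E v≢u)) (downsFirst⇒downsBeforeUps df u)
  downsFirst⇒downsBeforeUps (up∷ {v} {E} down∉ df) u = go (v ≟V u)
    where
    go : Dec (v ≡ u) → DownsBeforeUps (dirsAt u ((v , up) ∷ E))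
    go (yes refl) = subst DownsBeforeUps (sym (dirsAt-∷-≡ v up E)) (down∉⇒allUp E down∉)
    go (no v≢u)   = subst DownsBeforeUps (sym (dirsAt-∷-≢ up E v≢u)) (downsFirst⇒downsBeforeUps df u)

  -- Sets described by good multisets of arrows

  -- Exhibits S as the set of good multisets of the right size: `arrows` is injective up to
  -- permutation and `realise` gives preimages. Two sets described in this way are in bijection,
  -- since both composites preserve the multiset.
  record Description (n : ℕ) (S : Setoid 0ℓ 0ℓ) : Set where
    open Setoid S using (Carrier; _≈_)
    field
      arrows           : Carrier → List Arrow
      arrows-cong      : ∀ {x y} → x ≈ y → arrows x ↭ arrows y
      arrows-injective : ∀ {x y} → arrows x ↭ arrows y → x ≈ y
      arrows-good      : ∀ x → Good origin (arrows x)
      arrows-length    : ∀ x → length (arrows x) ≡ N ℕ.* n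
      realise          : ∀ {E} → Good origin E → length E ≡ N ℕ.* n → Carrier
      arrows-realise   : ∀ {E} (good : Good origin E) (len : length E ≡ N ℕ.* n) → arrows (realise good len) ↭ E

  description⇒inverse : ∀ {n S T} → Description n S → Description n T → Inverse S T
  description⇒inverse {S = S} {T} D D′ = record
    { to        = to
    ; from      = from
    ; to-cong   = λ {x} {y} eq → D′.arrows-injective
        (↭-trans (to-arrows x) (↭-trans (D.arrows-cong eq) (↭-sym (to-arrows y))))
    ; from-cong = λ {x} {y} eq → D.arrows-injective
        (↭-trans (from-arrows x) (↭-trans (D′.arrows-cong eq) (↭-sym (from-arrows y))))
    ; inverse   =
        (λ {x} {y} eq → D′.arrows-injective (↭-trans (to-arrows y) (↭-trans (D.arrows-cong eq) (from-arrows x)))) ,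
        (λ {x} {y} eq → D.arrows-injective (↭-trans (from-arrows y) (↭-trans (D′.arrows-cong eq) (to-arrows x))))
    }
    where
    module D = Description D
    module D′ = Description D′
    to : Setoid.Carrier S → Setoid.Carrier T
    to x = D′.realise (D.arrows-good x) (D.arrows-length x)
    from : Setoid.Carrier T → Setoid.Carrier S
    from y = D.realise (D′.arrows-good y) (D′.arrows-length y)
    to-arrows : ∀ x → D′.arrows (to x) ↭ D.arrows x
    to-arrows x = D′.arrows-realise (D.arrows-good x) (D.arrows-length x)
    from-arrows : ∀ y → D.arrows (from y) ↭ D′.arrows y
    from-arrows y = D.arrows-realise (D′.arrows-good y) (D′.arrows-length y)

  cycle-good : ∀ l → run origin l ≡ origin → Inside (trail origin l) → Good origin (trail origin l)
  cycle-good l closed ins = record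
    { inside    = ins
    ; balanced  = cycle-balanced origin l closed
    ; connected = λ u∈ → proj₁ (reach-visited origin l (λ e∈ → e∈) (src⊆visited origin l u∈))
    }

  verts-word : ∀ p q → start p ≡ start q → pathWord p ≡ pathWord q → verts p ≡ verts q
  verts-word p q eq eq′ = cong₂ _∷_ eq (trans (rest-visits p) (trans (cong₂ visits eq eq′) (sym (rest-visits q))))

  cycles : ∀ n → Description n (DFCycleSetoid n)
  cycles n = record
    { arrows           = arrows
    ; arrows-cong      = λ { {p , p₀ , _} {q , q₀ , _} eq → ↭-reflexive (cong (trail origin)
        (visits-injective origin _ _ (trans (sym (restO p p₀)) (trans (ListP.∷-injectiveʳ eq) (restO q q₀))))) }
    ; arrows-injective = λ { {x@(p , p₀ , _)} {y@(q , q₀ , _)} eq → verts-word p q (trans p₀ (sym q₀))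
        (downsFirst-unique origin (pathWord p) (pathWord q) (df x) (df y) eq) }
    ; arrows-good      = λ { (p , refl , closed , _) →
        cycle-good (pathWord p) (trans (sym (endV-run p)) closed) (path-inside p) }
    ; arrows-length    = λ { (p , _ , _ , _ , len) → trans (length-trail origin (pathWord p)) (trans (sym (len-word p)) len) }
    ; realise          = realise
    ; arrows-realise   = λ good len → ↭-trans
        (↭-reflexive (cong (trail origin) (pathWord-wordPath origin (Tour.word (tour good)) origin-InH (ins good))))
        (Tour.uses-all (tour good))
    }
    where
    arrows : DFCycle n → List Arrow
    arrows (p , _) = trail origin (pathWord p)
    restO : ∀ p → start p ≡ origin → rest p ≡ visits origin (pathWord p)
    restO p eq = trans (rest-visits p) (cong (λ v → visits v (pathWord p)) eq)
    df : ∀ x → DownsFirstᴸ (arrows x)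
    df (p , refl , _ , dfp , _) = downsBeforeUps⇒downsFirst _ λ u →
      subst (λ ss → DownsBeforeUps (map dirOf (filter (λ s → proj₁ s ≟V u) ss))) (steps-path p) (dfp u)
    ins : ∀ {E} (good : Good origin E) → Inside (trail origin (Tour.word (tour good)))
    ins good = ↭P.All-resp-↭ (↭-sym (Tour.uses-all (tour good))) (inside good)
    realise : ∀ {E} → Good origin E → length E ≡ N ℕ.* n → DFCycle n
    realise {E} good len = wordPath origin word origin-InH (ins good) , refl ,
      trans (lastV-visits origin word) closed ,
      (λ u → subst (λ ss → DownsBeforeUps (map dirOf (filter (λ s → proj₁ s ≟V u) ss)))
        (sym (steps-visits origin word)) (downsFirst⇒downsBeforeUps downsFirst u)) ,
      trans (length-visits origin word) (trans (sym (length-trail origin word)) (trans (↭P.↭-length uses-all) len))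
      where open Tour (tour good)

  lapWord : LapCycle → Word
  lapWord c = pathWord (proj₁ c)

  lapWord-lap : ∀ c → LapWord (lapWord c)
  lapWord-lap (p , refl , (len , _) , closed) = trans (sym (len-word p)) len , trans (sym (endV-run p)) closed

  wordLap : ∀ l → LapWord l → LapCycle
  wordLap l lap@(len , closed) = wordPath origin l origin-InH (lap-inside {l} lap) , refl ,
    (trans (length-visits origin l) len , refl , cong proj₁ end) , end
    where
    end : lastV origin (visits origin l) ≡ origin
    end = trans (lastV-visits origin l) closed

  wordLaps : ∀ {n} {ls : Vec Word n} → VAll LapWord ls → Vec LapCycle n
  wordLaps []           = []
  wordLaps (_∷_ {x = l} lap laps) = wordLap l lap ∷ wordLaps laps

  lapWords-wordLaps : ∀ {n} {ls : Vec Word n} (laps : VAll LapWord ls) → Vec.map lapWord (wordLaps laps) ≡ ls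
  lapWords-wordLaps []                     = refl
  lapWords-wordLaps (_∷_ {x = l} lap laps) =
    cong₂ _∷_ (pathWord-wordPath origin l origin-InH (lap-inside {l} lap)) (lapWords-wordLaps laps)

  lapWords-laps : ∀ {n} (cs : Vec LapCycle n) → VAll LapWord (Vec.map lapWord cs)
  lapWords-laps []       = []
  lapWords-laps (c ∷ cs) = lapWord-lap c ∷ lapWords-laps cs

  lapVerts : ∀ {n} → Vec LapCycle n → Vec (List V) n
  lapVerts = Vec.map (λ c → verts (proj₁ c))

  lapVerts⇒words : ∀ {n} (cs cs′ : Vec LapCycle n) → lapVerts cs ≡ lapVerts cs′ → Vec.map lapWord cs ≡ Vec.map lapWord cs′
  lapVerts⇒words []       []         eq = refl
  lapVerts⇒words ((p , p₀ , _) ∷ cs) ((q , q₀ , _) ∷ cs′) eq = cong₂ _∷_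
    (visits-injective (start p) _ _ (trans (sym (rest-visits p)) (trans (ListP.∷-injectiveʳ (VecP.∷-injectiveˡ eq))
      (trans (rest-visits q) (cong (λ v → visits v (pathWord q)) (trans q₀ (sym p₀)))))))
    (lapVerts⇒words cs cs′ (VecP.∷-injectiveʳ eq))

  words⇒lapVerts : ∀ {n} (cs cs′ : Vec LapCycle n) → Vec.map lapWord cs ≡ Vec.map lapWord cs′ → lapVerts cs ≡ lapVerts cs′
  words⇒lapVerts []       []         eq = refl
  words⇒lapVerts ((p , p₀ , _) ∷ cs) ((q , q₀ , _) ∷ cs′) eq = cong₂ _∷_
    (verts-word p q (trans p₀ (sym q₀)) (VecP.∷-injectiveˡ eq)) (words⇒lapVerts cs cs′ (VecP.∷-injectiveʳ eq))

  lapSequences : ∀ n → Description n (LapSeqSetoid n)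
  lapSequences n = record
    { arrows           = λ cs → stack (Vec.map lapWord cs)
    ; arrows-cong      = λ {cs} {cs′} eq → ↭-reflexive (cong stack (lapVerts⇒words cs cs′ eq))
    ; arrows-injective = λ {cs} {cs′} p → words⇒lapVerts cs cs′
        (stack-injective _ _ (lapWords-laps cs) (lapWords-laps cs′) p)
    ; arrows-good      = λ cs → stack-good _ (lapWords-laps cs)
    ; arrows-length    = λ cs → stack-length _ (lapWords-laps cs)
    ; realise          = λ {E} good len → wordLaps (proj₁ (proj₂ (unstack n E good len)))
    ; arrows-realise   = λ {E} good len → ↭-trans
        (↭-reflexive (cong stack (lapWords-wordLaps (proj₁ (proj₂ (unstack n E good len))))))
        (proj₂ (proj₂ (unstack n E good len)))
    }

  -- Weights as multisets of arrows

  prev-< : ∀ {x} → x < N → prev x < N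
  prev-< {zero}  _   = ℕP.≤-reflexive (ℕP.m+[n∸m]≡n 0<N)
  prev-< {suc x} x<N = ℕP.<-trans (ℕP.n<1+n x) x<N

  next-prev : ∀ {x} → x < N → next (prev x) ≡ x
  next-prev {zero}  _   = next-≡ (ℕP.m+[n∸m]≡n 0<N)
  next-prev {suc x} x<N = next-< x<N

  -- Applied to `src` and `tgt`, whose fibre over a vertex consists of two arrows, one up and one
  -- down; this turns out-weights and in-weights into multiplicities of vertices.
  count-fibre : ∀ (f : Arrow → V) {v p q} E → f p ≡ v → f q ≡ v → p ≢ q →
    All (λ e → f e ≡ v → e ≡ p ⊎ e ≡ q) E → count p E ℕ.+ count q E ≡ #V.count v (map f E)
  count-fibre f [] _ _ _ [] = refl
  count-fibre f {v} {p} {q} (e ∷ E) fp fq p≢q (fib ∷ fibs) = go (f e ≟V v)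
    where
    ih = count-fibre f E fp fq p≢q fibs
    go : Dec (f e ≡ v) → count p (e ∷ E) ℕ.+ count q (e ∷ E) ≡ #V.count v (f e ∷ map f E)
    go (no fe≢v) = trans (cong₂ ℕ._+_ (count-∷-≢ {p} {e} E (λ { refl → fe≢v fp })) (count-∷-≢ {q} {e} E (λ { refl → fe≢v fq })))
      (trans ih (sym (#V.count-∷-≢ (map f E) fe≢v)))
    go (yes refl) with fib refl
    ... | inj₁ refl = trans (cong₂ ℕ._+_ (count-∷-≡ p E) (count-∷-≢ {q} {p} E p≢q))
      (trans (cong suc ih) (sym (#V.count-∷-≡ (f e) (map f E))))
    ... | inj₂ refl = trans (cong₂ ℕ._+_ (count-∷-≢ {p} {q} E (p≢q ∘ sym)) (count-∷-≡ q E))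
      (trans (ℕP.+-suc (count p E) (count q E)) (trans (cong suc ih) (sym (#V.count-∷-≡ (f e) (map f E)))))

  -- Nothing is said about arrows outside H, so this fixes the multiset only in combination with
  -- `Inside`.
  Represents : List Arrow → Weight → Set
  Represents E w = ∀ u d (pu : InH u) (pt : InH (step u d)) → w u d pu pt ≡ count (u , d) E

  represents-↭ : ∀ {E F} → Inside E → Inside F → {w : Weight} → Represents E w → Represents F w → E ↭ F
  represents-↭ {E} {F} insE insF repE repF = count-≗⇒↭ E F λ (u , d) → go u d (InH? u) (InH? (step u d))
    where
    go : ∀ u d → Dec (InH u) → Dec (InH (step u d)) → count (u , d) E ≡ count (u , d) F
    go u d (yes pu) (yes pt) = trans (sym (repE u d pu pt)) (repF u d pu pt)
    go u d (no ¬pu) _        = trans (∉⇒count≡0 E λ e∈ → ¬pu (proj₁ (All.lookup insE e∈)))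
      (sym (∉⇒count≡0 F λ e∈ → ¬pu (proj₁ (All.lookup insF e∈))))
    go u d (yes _)  (no ¬pt) = trans (∉⇒count≡0 E λ e∈ → ¬pt (proj₂ (All.lookup insE e∈)))
      (sym (∉⇒count≡0 F λ e∈ → ¬pt (proj₂ (All.lookup insF e∈))))

  module _ {E : List Arrow} (ins : Inside E) {w : Weight} (rep : Represents E w) where

    wAt-count : ∀ u d → wAt w u d ≡ count (u , d) E
    wAt-count u d with InH? u | InH? (step u d)
    ... | yes pu | yes pt = rep u d pu pt
    ... | no ¬pu | _      = sym (∉⇒count≡0 E λ e∈ → ¬pu (proj₁ (All.lookup ins e∈)))
    ... | yes _  | no ¬pt = sym (∉⇒count≡0 E λ e∈ → ¬pt (proj₂ (All.lookup ins e∈)))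

    outW-count : ∀ v → outW w v ≡ #V.count v (map src E)
    outW-count v = trans (cong₂ ℕ._+_ (wAt-count v up) (wAt-count v down))
      (count-fibre src E refl refl (λ ()) (All.universal (λ { (_ , up) refl → inj₁ refl ; (_ , down) refl → inj₂ refl }) E))

    -- `prev` inverts `next` only on columns below N. The hypothesis supplies this bound for v, and
    -- `Inside` supplies it for the sources.
    inW-count : ∀ v → proj₁ v < N → inW w v ≡ #V.count v (map tgt E)
    inW-count v@(x , y) x<N = trans (cong₂ ℕ._+_ (wAt-count _ up) (wAt-count _ down))
      (count-fibre tgt E (cong₂ _,_ (next-prev x<N) (cancel⁻ y (+ a))) (cong₂ _,_ (next-prev x<N) (cancel⁺ y (+ b)))
        (λ ()) (All.map fibre ins))
      where
      cancel⁻ : ∀ Y A → Y ℤ.- A ℤ.+ A ≡ Y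
      cancel⁻ = ℤSolver.solve-∀
      cancel⁺ : ∀ Y A → Y ℤ.+ A ℤ.- A ≡ Y
      cancel⁺ = ℤSolver.solve-∀
      fibre : ∀ {e} → InH (src e) × InH (tgt e) → tgt e ≡ v →
        e ≡ ((prev x , y ℤ.- + a) , up) ⊎ e ≡ ((prev x , y ℤ.+ + b) , down)
      fibre {(x′ , y′) , up} (((x′<N , _) , _) , _) eq = inj₁ (cong (_, up) (cong₂ _,_
        (next-injective x′<N (prev-< x<N) (trans (cong proj₁ eq) (sym (next-prev x<N))))
        (trans (sym (cancel⁺ y′ (+ a))) (cong (ℤ._- + a) (cong proj₂ eq)))))
      fibre {(x′ , y′) , down} (((x′<N , _) , _) , _) eq = inj₂ (cong (_, down) (cong₂ _,_
        (next-injective x′<N (prev-< x<N) (trans (cong proj₁ eq) (sym (next-prev x<N))))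
        (trans (sym (cancel⁻ y′ (+ b))) (cong (ℤ._+ + b) (cong proj₂ eq)))))

    balanced⇒balancedᴸ : Balanced w → Balancedᴸ E
    balanced⇒balancedᴸ bal = #V.count-≗⇒↭ (map src E) (map tgt E) λ v → go v (InH? v)
      where
      tgt-InH : ∀ {v} → v ∈ map tgt E → InH v
      tgt-InH v∈ with ∈P.∈-map⁻ tgt v∈
      ... | e , e∈ , refl = proj₂ (All.lookup ins e∈)
      go : ∀ v → Dec (InH v) → #V.count v (map src E) ≡ #V.count v (map tgt E)
      go v (yes v∈H) = trans (sym (outW-count v)) (trans (sym (bal v v∈H)) (inW-count v (proj₁ (proj₁ v∈H))))
      go v (no v∉H)  = trans (#V.∉⇒count≡0 (map src E) (v∉H ∘ src-InH ins))
        (sym (#V.∉⇒count≡0 (map tgt E) (v∉H ∘ tgt-InH)))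

    balancedᴸ⇒balanced : Balancedᴸ E → Balanced w
    balancedᴸ⇒balanced bal v v∈H = trans (inW-count v (proj₁ (proj₁ v∈H)))
      (trans (sym (#V.count-↭ v bal)) (sym (outW-count v)))

    connected⇒reach : OriginConnected w → ∀ {u} → u ∈ map src E → Reach E origin u
    connected⇒reach conn {u} u∈
      with conn u (src-InH ins u∈) (subst (0 <_) (sym (outW-count u)) (#V.∈⇒count>0 u∈))
    ... | p , refl , refl , covered =
      subst (Reach E origin) (sym (endV-run p)) (reach-run origin (pathWord p) used)
      where
      used : trail origin (pathWord p) ⊆ E
      used {u , d} e∈ = count>0⇒∈ E (subst (0 <_) (rep u d pu pt)
        (ℕP.≤-trans (subst (0 <_) (sym (uses-count p u d)) (∈⇒count>0 e∈)) (covered u d pu pt)))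
        where
        pu = proj₁ (All.lookup (path-inside p) e∈)
        pt = proj₂ (All.lookup (path-inside p) e∈)

    -- Initial segments of the tour are covered and reach every vertex with an arrow.
    good⇒connected : Good origin E → OriginConnected w
    good⇒connected good v v∈H 0<out
      with visited-split origin word (src⊆visited origin word
             (↭P.∈-resp-↭ (↭P.map⁺ src (↭-sym uses-all)) (#V.count>0⇒∈ (map src E) (subst (0 <_) (outW-count v) 0<out))))
      where open Tour (tour good)
    ... | l₁ , l₂ , eq , run≡ = p , refl , trans (lastV-visits origin l₁) run≡ , covered
      where
      open Tour (tour good)
      split : trail origin word ≡ trail origin l₁ ++ trail (run origin l₁) l₂
      split = trans (cong (trail origin) eq) (trail-++ origin l₁ l₂)
      ins₁ : Inside (trail origin l₁)
      ins₁ = AllP.++⁻ˡ (trail origin l₁) (subst Inside split (↭P.All-resp-↭ (↭-sym uses-all) ins))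
      p : Path
      p = wordPath origin l₁ origin-InH ins₁
      covered : Covered w p
      covered u d pu pt = begin
        uses p u d                                          ≡⟨ uses-count p u d ⟩
        count (u , d) (trail origin (pathWord p))           ≡⟨ cong (count (u , d) ∘ trail origin) (pathWord-wordPath origin l₁ origin-InH ins₁) ⟩
        count (u , d) (trail origin l₁)                     ≤⟨ ℕP.m≤m+n _ _ ⟩
        count (u , d) (trail origin l₁) ℕ.+ count (u , d) (trail (run origin l₁) l₂)
                                                            ≡⟨ sym (count-++ (u , d) (trail origin l₁) _) ⟩
        count (u , d) (trail origin l₁ ++ trail (run origin l₁) l₂)
                                                            ≡⟨ cong (count (u , d)) (sym split) ⟩
        count (u , d) (trail origin word)                   ≡⟨ count-↭ (u , d) uses-all ⟩
        count (u , d) E                                     ≡⟨ sym (rep u d pu pt) ⟩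
        w u d pu pt                                         ∎
        where open ℕP.≤-Reasoning

    hedges : ∀ {ks} → Inside ks → List HEdge
    hedges []                            = []
    hedges (_∷_ {x = u , d} (pu , pt) i) = record { src = u ; dir = d ; srcIn = pu ; tgtIn = pt } ∷ hedges i

    hedges-key : ∀ {ks} (i : Inside ks) → map key (hedges i) ≡ ks
    hedges-key []      = refl
    hedges-key (_ ∷ i) = cong (_ ∷_) (hedges-key i)

    hedges-sum : ∀ {ks} (i : Inside ks) → sum (map (wt w) (hedges i)) ≡ sum (map (λ k → count k E) ks)
    hedges-sum []                            = refl
    hedges-sum (_∷_ {x = u , d} (pu , pt) i) = cong₂ ℕ._+_ (rep u d pu pt) (hedges-sum i)

    totalWeight : TotalWeight w (length E)
    totalWeight = hedges i , subst Unique (sym (hedges-key i)) (deduplicate-! E) ,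
      (λ e 0< → subst (key e ∈_) (sym (hedges-key i)) (∈P.∈-deduplicate⁺ _≟A_
        (count>0⇒∈ E (subst (0 <_) (rep _ _ (HEdge.srcIn e) (HEdge.tgtIn e)) 0<)))) ,
      -- Summing the multiplicities over the deduplicated list counts every entry of E once.
      trans (hedges-sum i) (sum-count (deduplicate-! E) (All.tabulate (∈P.∈-deduplicate⁺ _≟A_)))
      where
      i : Inside (deduplicate _≟A_ E)
      i = AllP.deduplicate⁺ _≟A_ ins

  count-replicate-≡ : ∀ k n → count k (replicate n k) ≡ n
  count-replicate-≡ k zero    = refl
  count-replicate-≡ k (suc n) = trans (count-∷-≡ k (replicate n k)) (cong suc (count-replicate-≡ k n))

  ∈-replicate⁻ : ∀ {k j : Arrow} n → k ∈ replicate n j → k ≡ j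
  ∈-replicate⁻ (suc n) (here eq)  = eq
  ∈-replicate⁻ (suc n) (there k∈) = ∈-replicate⁻ n k∈

  module _ (w : Weight) where

    -- The finite support that comes with the total weight is what makes the weight function
    -- listable as a multiset.
    expand : List HEdge → List Arrow
    expand []       = []
    expand (e ∷ es) = replicate (wt w e) (key e) ++ expand es

    ∈-expand⁻ : ∀ {k} es → k ∈ expand es → k ∈ map key es
    ∈-expand⁻ (e ∷ es) k∈ with ∈P.∈-++⁻ (replicate (wt w e) (key e)) k∈
    ... | inj₁ k∈r = here (∈-replicate⁻ (wt w e) k∈r)
    ... | inj₂ k∈s = there (∈-expand⁻ es k∈s)

    expand-inside : ∀ es → Inside (expand es)
    expand-inside es = All.tabulate λ k∈ → key-inside (∈P.∈-map⁻ key (∈-expand⁻ es k∈))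
      where
      key-inside : ∀ {k es} → (∃ λ e → e ∈ es × k ≡ key e) → InH (src k) × InH (tgt k)
      key-inside (e , _ , refl) = HEdge.srcIn e , HEdge.tgtIn e

    expand-length : ∀ es → length (expand es) ≡ sum (map (wt w) es)
    expand-length []       = refl
    expand-length (e ∷ es) = trans (ListP.length-++ (replicate (wt w e) (key e)))
      (cong₂ ℕ._+_ (ListP.length-replicate (wt w e)) (expand-length es))

    expand-count : ∀ {es e} → Unique (map key es) → e ∈ es → count (key e) (expand es) ≡ wt w e
    expand-count {e ∷ es} (e≢ ∷ _) (here refl) = trans (count-++ (key e) (replicate (wt w e) (key e)) (expand es))
      (trans (cong₂ ℕ._+_ (count-replicate-≡ (key e) (wt w e))
        (∉⇒count≡0 (expand es) λ k∈ → All.lookup e≢ (∈-expand⁻ es k∈) refl)) (ℕP.+-identityʳ (wt w e)))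
    expand-count {f ∷ es} {e} (f≢ ∷ uniq) (there e∈) = trans (count-++ (key e) (replicate (wt w f) (key f)) (expand es))
      (cong₂ ℕ._+_ (∉⇒count≡0 (replicate (wt w f) (key f)) λ k∈ →
          All.lookup f≢ (∈P.∈-map⁺ key e∈) (sym (∈-replicate⁻ (wt w f) k∈)))
        (expand-count uniq e∈))

    expand-represents : ∀ es → Unique (map key es) → ((e : HEdge) → 0 < wt w e → key e ∈ map key es) →
      Represents (expand es) w
    expand-represents es uniq support u d pu pt = go ((u , d) ∈A? map key es)
      where
      e : HEdge
      e = record { src = u ; dir = d ; srcIn = pu ; tgtIn = pt }
      go : Dec ((u , d) ∈ map key es) → w u d pu pt ≡ count (u , d) (expand es)
      go (yes k∈) with ∈P.∈-map⁻ key k∈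
      -- The listed edge f may carry other proofs of membership in H than e; weights take these
      -- irrelevantly, so both get the same value.
      ... | f , f∈ , refl = sym (expand-count uniq f∈)
      go (no k∉) = trans (ℕP.n≤0⇒n≡0 (ℕP.≮⇒≥ (k∉ ∘ support e))) (sym (∉⇒count≡0 (expand es) (k∉ ∘ ∈-expand⁻ es)))

  module _ {n : ℕ} where

    weightArrows : GoodWeight n → List Arrow
    weightArrows (w , _ , _ , es , _) = expand w es

    weightArrows-inside : ∀ x → Inside (weightArrows x)
    weightArrows-inside (w , _ , _ , es , _) = expand-inside w es

    weightArrows-represents : ∀ x → Represents (weightArrows x) (proj₁ x)
    weightArrows-represents (w , _ , _ , es , uniq , support , _) = expand-represents w es uniq support

    weightArrows-length : ∀ x → length (weightArrows x) ≡ N ℕ.* n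
    weightArrows-length (w , _ , _ , es , _ , _ , total) = trans (expand-length w es) total

    weightArrows-good : ∀ x → Good origin (weightArrows x)
    weightArrows-good x@(w , bal , conn , _) = record
      { inside    = ins
      ; balanced  = balanced⇒balancedᴸ ins {w} rep bal
      ; connected = connected⇒reach ins {w} rep conn
      }
      where
      ins = weightArrows-inside x
      rep = weightArrows-represents x

    countWeight : List Arrow → Weight
    countWeight E u d _ _ = count (u , d) E

    countWeight-represents : ∀ E → Represents E (countWeight E)
    countWeight-represents E u d pu pt = refl

    goodWeight : ∀ {E} → Good origin E → length E ≡ N ℕ.* n → GoodWeight n
    goodWeight {E} good len = countWeight E ,
      balancedᴸ⇒balanced (inside good) {countWeight E} (countWeight-represents E) (balanced good) ,
      good⇒connected (inside good) {countWeight E} (countWeight-represents E) good ,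
      subst (TotalWeight (countWeight E)) len (totalWeight (inside good) {countWeight E} (countWeight-represents E))

  weights : ∀ n → Description n (GoodWeightSetoid n)
  weights n = record
    { arrows           = weightArrows
    ; arrows-cong      = λ {x} {y} eq → represents-↭ (weightArrows-inside x) (weightArrows-inside y) {proj₁ y}
        (λ u d pu pt → trans (sym (eq u d pu pt)) (weightArrows-represents x u d pu pt)) (weightArrows-represents y)
    ; arrows-injective = λ {x} {y} p u d pu pt → trans (weightArrows-represents x u d pu pt)
        (trans (count-↭ (u , d) p) (sym (weightArrows-represents y u d pu pt)))
    ; arrows-good      = weightArrows-good
    ; arrows-length    = weightArrows-length
    ; realise          = goodWeight
    ; arrows-realise   = λ {E} good len → represents-↭ (weightArrows-inside (goodWeight good len)) (inside good)
        {countWeight {n} E} (weightArrows-represents (goodWeight good len)) (countWeight-represents {n} E)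
    }

theorem2 : (a b : ℕ) → 0 < a → 0 < b → (n : ℕ) →
    Inverse (Graph.DFCycleSetoid a b n) (Graph.GoodWeightSetoid a b n)
    × Inverse (Graph.DFCycleSetoid a b n) (Graph.LapSeqSetoid a b n)
theorem2 a b 0<a _ n = description⇒inverse (cycles n) (weights n) , description⇒inverse (cycles n) (lapSequences n)
  where open Bijections a b 0<a
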